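{- Let $E$ be an elliptic curve over $\mathbb{Q}$ that has a $\mathbb{Q}$-rational point of order $9$. Assume moreover that the conductor of $E$ is $N_E=p^{\alpha}q^{\beta}$, where $p\neq q$ are primes and $\alpha,\beta>0$ are integers. Then the minimal discriminant is $\Delta_E=-2^9\cdot 3^5$. In particular, $|\Delta_E|<N_E^5$, and Szpiro's conjecture holds for these curves: for every $\epsilon>0$ there is a constant $C_\epsilon$ such that $|\Delta_E|\le C_\epsilon N_E^{6+\epsilon}$ for every such $E$.
   Context: For an elliptic curve $E/\mathbb{Q}$, $\Delta_E$ denotes its minimal discriminant and $N_E$ its conductor. Szpiro's conjecture is the assertion that $|\Delta_E|\ll_{\epsilon}N_E^{6+\epsilon}$ for elliptic curves $E/\mathbb{Q}$. -}

module Defs where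

open import Algebra.Bundles using (CommutativeRing; Semiring)
open import Algebra.Morphism.Structures using (IsRingHomomorphism; IsRingIsomorphism)
open import Data.Fin.Base using (Fin)
open import Data.Fin.Subset using (Subset; _∈_; ∣_∣)
open import Data.Integer.Base as ℤ using (ℤ)
import Data.Integer.Divisibility as ℤ
import Data.Integer.Properties as ℤ
open import Data.List.Base using (map; upTo)
open import Data.Nat.Base as ℕ using (ℕ; zero; suc)
import Data.Nat.Divisibility as ℕ
open import Data.Nat.ListAction using (sum)
open import Data.Nat.Primality using (Prime)
open import Data.Product.Base using (Σ; ∃; ∃-syntax; _×_; _,_)
open import Data.Rational.Base as ℚ using (ℚ; ↥_; ↧ₙ_)
import Data.Rational.Properties as ℚ
open import Data.Sum.Base using (_⊎_)
open import Data.Unit.Base using (⊤)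
open import Data.Empty using (⊥)
open import Function.Bundles using (_⇔_)
open import Level using (0ℓ)
open import Relation.Binary.PropositionalEquality.Core using (_≡_; _≢_)
open import Relation.Nullary.Negation.Core using (¬_)

Ring : Set₁
Ring = CommutativeRing 0ℓ 0ℓ

ℤ-ring ℚ-ring : Ring
ℤ-ring = ℤ.+-*-commutativeRing
ℚ-ring = ℚ.+-*-commutativeRing

ℤ→ℚ : ℤ → ℚ
ℤ→ℚ n = n ℚ./ 1

-- y² + a₁xy + a₃y = x³ + a₂x² + a₄x + a₆
record Weierstrass (A : Set) : Set where
  constructor weierstrass
  field
    a₁ a₂ a₃ a₄ a₆ : A

mapW : ∀ {A B : Set} → (A → B) → Weierstrass A → Weierstrass B
mapW f (weierstrass a₁ a₂ a₃ a₄ a₆) = weierstrass (f a₁) (f a₂) (f a₃) (f a₄) (f a₆)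

module WeierstrassOver (R : Ring) (W : Weierstrass (CommutativeRing.Carrier R)) where
  open CommutativeRing R
  open import Algebra.Definitions.RawSemiring (Semiring.rawSemiring semiring) using (_^_)
    renaming (_×_ to infixr 8 _·_)
  open Weierstrass W

  b₂ b₄ b₆ b₈ Δ : Carrier
  b₂ = a₁ ^ 2 + 4 · a₂
  b₄ = 2 · a₄ + a₁ * a₃
  b₆ = a₃ ^ 2 + 4 · a₆
  b₈ = a₁ ^ 2 * a₆ + 4 · (a₂ * a₆) - a₁ * a₃ * a₄ + a₂ * a₃ ^ 2 - a₄ ^ 2
  Δ  = 9 · (b₂ * b₄ * b₆) - b₂ ^ 2 * b₈ - 8 · b₄ ^ 3 - 27 · b₆ ^ 2

  f fˣ fʸ : Carrier → Carrier → Carrier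
  f  x y = (y ^ 2 + a₁ * x * y + a₃ * y) - (x ^ 3 + a₂ * x ^ 2 + a₄ * x + a₆)
  fˣ x y = a₁ * y - (3 · x ^ 2 + 2 · (a₂ * x) + a₄)
  fʸ x y = 2 · y + a₁ * x + a₃

  data Point : Set where
    𝒪   : Point
    aff : ∀ x y → f x y ≈ 0# → Point

  _≈ₚ_ : Point → Point → Set
  𝒪         ≈ₚ 𝒪           = ⊤
  aff x y _ ≈ₚ aff x′ y′ _ = x ≈ x′ × y ≈ y′
  _         ≈ₚ _           = ⊥

  -- λ′ is the slope of the line through (x₁ , y₁) and (x₂ , y₂), this line
  -- being the tangent when the two points coincide; it is not vertical.
  data IsSlope (x₁ y₁ x₂ y₂ λ′ : Carrier) : Set where
    chord   : ¬ x₁ ≈ x₂ → λ′ * (x₂ - x₁) ≈ y₂ - y₁ → IsSlope x₁ y₁ x₂ y₂ λ′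
    tangent : x₁ ≈ x₂ → y₁ ≈ y₂ → ¬ fʸ x₁ y₁ ≈ 0# →
              λ′ * fʸ x₁ y₁ ≈ - fˣ x₁ y₁ → IsSlope x₁ y₁ x₂ y₂ λ′

  -- P + Q = S in the chord–tangent group law.  This relation is the graph of
  -- the group law when R is a field with decidable equality and Δ is nonzero,
  -- the only situation in which it is used.
  IsSum : Point → Point → Point → Set
  IsSum 𝒪             Q             S             = Q ≈ₚ S
  IsSum (aff x y e)   𝒪             S             = aff x y e ≈ₚ S
  IsSum (aff x₁ y₁ _) (aff x₂ y₂ _) 𝒪             =
    x₁ ≈ x₂ × y₂ ≈ - y₁ - a₁ * x₁ - a₃
  IsSum (aff x₁ y₁ _) (aff x₂ y₂ _) (aff x₃ y₃ _) =
    ∃[ λ′ ] IsSlope x₁ y₁ x₂ y₂ λ′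
          × x₃ ≈ λ′ ^ 2 + a₁ * λ′ - a₂ - x₁ - x₂
          × y₃ ≈ - (λ′ + a₁) * x₃ - (y₁ - λ′ * x₁) - a₃

  IsMultiple : ℕ → Point → Point → Set
  IsMultiple zero    P Q = Q ≈ₚ 𝒪
  IsMultiple (suc n) P Q = ∃[ S ] IsMultiple n P S × IsSum S P Q

  HasOrder : ℕ → Point → Set
  HasOrder n P =
    IsMultiple n P 𝒪 × (∀ m → 0 ℕ.< m → m ℕ.< n → ¬ IsMultiple m P 𝒪)

  Fixes : (Carrier → Carrier) → Point → Set
  Fixes σ 𝒪           = ⊤
  Fixes σ (aff x y _) = σ x ≈ x × σ y ≈ y

open WeierstrassOver using (Δ; Point; 𝒪; aff)

record EllipticCurve : Set where
  field
    equation    : Weierstrass ℚ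
    nonsingular : Δ ℚ-ring equation ≢ ℚ.0ℚ

open EllipticCurve public

HasRationalPointOfOrder : EllipticCurve → ℕ → Set
HasRationalPointOfOrder E n = ∃ (WeierstrassOver.HasOrder ℚ-ring (equation E) n)

-- W′ arises from W by the substitution x = u²x′ + r, y = u³y′ + u²sx′ + t.
_≅_ : Weierstrass ℚ → Weierstrass ℚ → Set
W ≅ W′ = ∃[ u ] ∃[ r ] ∃[ s ] ∃[ t ]
    u ≢ ℚ.0ℚ
  × u     * a₁′ ≡ a₁ + 2 · s
  × u ^ 2 * a₂′ ≡ a₂ - s * a₁ + 3 · r - s ^ 2
  × u ^ 3 * a₃′ ≡ a₃ + r * a₁ + 2 · t
  × u ^ 4 * a₄′ ≡ a₄ - s * a₃ + 2 · (r * a₂) - (t + r * s) * a₁ + 3 · r ^ 2 - 2 · (s * t)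
  × u ^ 6 * a₆′ ≡ a₆ + r * a₄ + r ^ 2 * a₂ + r ^ 3 - t * a₃ - t ^ 2 - r * t * a₁
  where
  open CommutativeRing ℚ-ring using (_+_; _*_; _-_; semiring)
  open import Algebra.Definitions.RawSemiring (Semiring.rawSemiring semiring) using (_^_)
    renaming (_×_ to infixr 8 _·_)
  open Weierstrass W
  open Weierstrass W′
    renaming (a₁ to a₁′; a₂ to a₂′; a₃ to a₃′; a₄ to a₄′; a₆ to a₆′)

IsIntegralModel : EllipticCurve → Weierstrass ℤ → Set
IsIntegralModel E W = equation E ≅ mapW ℤ→ℚ W

IsMinimalModel : EllipticCurve → Weierstrass ℤ → Set
IsMinimalModel E W =
    IsIntegralModel E W
  × (∀ W′ → IsIntegralModel E W′ → ℤ.∣ Δ ℤ-ring W ∣ ℕ.≤ ℤ.∣ Δ ℤ-ring W′ ∣)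

IsMinimalDiscriminant : EllipticCurve → ℤ → Set
IsMinimalDiscriminant E D = ∃[ W ] IsMinimalModel E W × Δ ℤ-ring W ≡ D

module Reduction (W : Weierstrass ℤ) (p : ℕ) where
  open WeierstrassOver ℤ-ring W using (f; fˣ; fʸ)
  open Weierstrass W

  _≡0 : ℤ → Set
  z ≡0 = ℤ.+ p ℤ.∣ z

  Good : Set
  Good = ¬ (Δ ℤ-ring W ≡0)

  -- (x , y) reduces to a singular point of the reduction mod p.  As 𝔽ₚ is
  -- perfect, a singular point over its algebraic closure is 𝔽ₚ-rational.
  SingularAt : ℤ → ℤ → Set
  SingularAt x y = f x y ≡0 × fˣ x y ≡0 × fʸ x y ≡0

  -- The quadratic part Y² + a₁XY - (3x + a₂)X² of the equation at a singular
  -- point is the square (Y - αX)²: there is only one tangent line.  Again α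
  -- lies in 𝔽ₚ because 𝔽ₚ is perfect.
  CoincidentTangentsAt : ℤ → Set
  CoincidentTangentsAt x = ∃[ α ]
      (a₁ ℤ.+ ℤ.+ 2 ℤ.* α) ≡0
    × (α ℤ.* α ℤ.+ (ℤ.+ 3 ℤ.* x ℤ.+ a₂)) ≡0

  NodeAt CuspAt : ℤ → ℤ → Set
  NodeAt x y = SingularAt x y × ¬ CoincidentTangentsAt x
  CuspAt x y = SingularAt x y × CoincidentTangentsAt x

record IsField (R : Ring) : Set where
  open CommutativeRing R
  field
    1≉0     : ¬ 1# ≈ 0#
    inverse : ∀ x → x ≈ 0# ⊎ (∃[ y ] x * y ≈ 1#)

record ExtensionOfℚ : Set₁ where
  field
    L       : Ring
    isField : IsField L
    ι       : ℚ → CommutativeRing.Carrier L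
    ι-hom   : IsRingHomomorphism (CommutativeRing.rawRing ℚ-ring) (CommutativeRing.rawRing L) ι

  open CommutativeRing L public

  IsAutomorphism : (Carrier → Carrier) → Set
  IsAutomorphism = IsRingIsomorphism rawRing rawRing

  -- The smallest subfield containing S.
  data Generated (S : Carrier → Set) : Carrier → Set where
    generator : ∀ {x} → S x → Generated S x
    from-ℚ    : ∀ q → Generated S (ι q)
    plus      : ∀ {x y} → Generated S x → Generated S y → Generated S (x + y)
    times     : ∀ {x y} → Generated S x → Generated S y → Generated S (x * y)
    inverse   : ∀ {x y} → Generated S x → x * y ≈ 1# → Generated S y
    respects  : ∀ {x y} → x ≈ y → Generated S x → Generated S y

-- K is the torsion field ℚ(E[ℓ]).
record IsTorsionField (E : EllipticCurve) (ℓ : ℕ) (K : ExtensionOfℚ) : Set where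
  open ExtensionOfℚ K
  open WeierstrassOver L (mapW ι (equation E)) using (IsMultiple; _≈ₚ_)

  field
    -- All of E[ℓ] is defined over K: it has its full number ℓ² of points there.
    torsion          : Fin (ℓ ℕ.* ℓ) → Point L (mapW ι (equation E))
    torsion-killed   : ∀ k → IsMultiple ℓ (torsion k) 𝒪
    torsion-distinct : ∀ j k → torsion j ≈ₚ torsion k → j ≡ k
    torsion-complete : ∀ P → IsMultiple ℓ P 𝒪 → ∃[ k ] torsion k ≈ₚ P

  IsCoordinate : Carrier → Set
  IsCoordinate z = ∃[ k ] ∃[ x ] ∃[ y ] ∃[ e ] torsion k ≡ aff x y e × (z ≡ x ⊎ z ≡ y)

  field
    generated : ∀ z → Generated IsCoordinate z

-- Field automorphisms fix ℚ, hence for K Galois over ℚ this is Gal(K/ℚ).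
record GaloisGroup (K : ExtensionOfℚ) : Set where
  open ExtensionOfℚ K
  field
    order        : ℕ
    aut          : Fin order → Carrier → Carrier
    aut-isAut    : ∀ j → IsAutomorphism (aut j)
    aut-distinct : ∀ i j → (∀ x → aut i x ≈ aut j x) → i ≡ j
    aut-complete : ∀ σ → IsAutomorphism σ → ∃[ j ] (∀ x → aut j x ≈ σ x)

-- A normalised discrete valuation of K above p.  The value v 0# is junk.
record Valuation (K : ExtensionOfℚ) (p : ℕ) : Set where
  open ExtensionOfℚ K
  field
    v : Carrier → ℤ

  HasValuation≥ : ℤ → Carrier → Set
  HasValuation≥ n x = x ≈ 0# ⊎ n ℤ.≤ v x

  field
    v-cong : ∀ {x y} → x ≈ y → v x ≡ v y
    v-*    : ∀ {x y} → ¬ x ≈ 0# → ¬ y ≈ 0# → v (x * y) ≡ v x ℤ.+ v y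
    v-+    : ∀ {n x y} → HasValuation≥ n x → HasValuation≥ n y → HasValuation≥ n (x + y)
    v-onto : ∃[ π ] ¬ π ≈ 0# × v π ≡ ℤ.+ 1
    v-p    : ℤ.+ 0 ℤ.< v (ι (ℤ→ℚ (ℤ.+ p)))

  -- The automorphisms in this set lie in the decomposition group of v, so this
  -- is the i-th ramification group (lower numbering) of the completion over ℚₚ.
  InRamificationGroup : ℕ → (Carrier → Carrier) → Set
  InRamificationGroup i σ =
    ∀ x → HasValuation≥ (ℤ.+ 0) x → HasValuation≥ (ℤ.+ suc i) (σ x - x)

-- δ = Σ_{i ≥ 1} (|Gᵢ| / |G₀|) · dim (E[ℓ] / E[ℓ]^Gᵢ) for a prime ℓ ≠ p, where the Gᵢ
-- are the ramification groups of ℚ(E[ℓ]) at a prime above p.  The value does not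
-- depend on the choice of ℓ and of this prime.
record IsWildExponent (E : EllipticCurve) (p δ : ℕ) : Set₁ where
  field
    ℓ              : ℕ
    ℓ-prime        : Prime ℓ
    ℓ≢p            : ℓ ≢ p
    K              : ExtensionOfℚ
    isTorsionField : IsTorsionField E ℓ K
    galoisGroup    : GaloisGroup K
    valuation      : Valuation K p

  open ExtensionOfℚ K
  open WeierstrassOver L (mapW ι (equation E)) using (Fixes)
  open IsTorsionField isTorsionField
  open GaloisGroup galoisGroup
  open Valuation valuation

  field
    G          : ℕ → Subset order
    G-spec     : ∀ i j → j ∈ G i ⇔ InRamificationGroup i (aut j)
    -- E[ℓ]^Gᵢ
    fixed      : ℕ → Subset (ℓ ℕ.* ℓ)
    fixed-spec : ∀ i k → k ∈ fixed i ⇔ (∀ j → j ∈ G i → Fixes (aut j) (torsion k))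
    -- the 𝔽_ℓ-dimension of E[ℓ] / E[ℓ]^Gᵢ, a space with ℓ² / |E[ℓ]^Gᵢ| elements
    codim      : ℕ → ℕ
    codim-spec : ∀ i → ℓ ℕ.^ codim i ℕ.* ∣ fixed i ∣ ≡ ℓ ℕ.* ℓ
    -- the terms of the sum with i ≥ m vanish
    m          : ℕ
    G-trivial  : ∣ G m ∣ ≡ 1
    formula    : δ ℕ.* ∣ G 0 ∣ ≡ sum (map (λ i → ∣ G (suc i) ∣ ℕ.* codim (suc i)) (upTo m))

-- W is a global minimal model of E.
data ConductorExponent (E : EllipticCurve) (W : Weierstrass ℤ) (p : ℕ) : ℕ → Set₁ where
  good           : Reduction.Good W p → ConductorExponent E W p 0
  multiplicative : ∀ {x y} → Reduction.NodeAt W p x y → ConductorExponent E W p 1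
  additive       : ∀ {x y δ} → Reduction.CuspAt W p x y → IsWildExponent E p δ →
                   ConductorExponent E W p (2 ℕ.+ δ)

record IsConductor (E : EllipticCurve) (N : ℕ) : Set₁ where
  field
    model    : Weierstrass ℤ
    minimal  : IsMinimalModel E model
    positive : 0 ℕ.< N
    -- the p-adic valuation of N is the conductor exponent at p
    exponent : ∀ p → Prime p → Σ ℕ λ e →
      ConductorExponent E model p e × p ℕ.^ e ℕ.∣ N × ¬ (p ℕ.^ suc e ℕ.∣ N)

-- Dedekind reals.
record ℝ : Set₁ where
  field
    Lower Upper     : ℚ → Set
    lower-inhabited : ∃ Lower
    upper-inhabited : ∃ Upper
    lower-rounded   : ∀ q → Lower q ⇔ (∃[ r ] q ℚ.< r × Lower r)
    upper-rounded   : ∀ r → Upper r ⇔ (∃[ q ] q ℚ.< r × Upper q)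
    disjoint        : ∀ q → ¬ (Lower q × Upper q)
    located         : ∀ q r → q ℚ.< r → Lower q ⊎ Upper r

Positive : ℝ → Set
Positive ε = ℝ.Lower ε ℚ.0ℚ

-- x ≤ C · N^r for a rational r = a / b ≥ 0, in the form xᵇ ≤ Cᵇ · Nᵃ.
_≤_·_^ℚ_ : ℕ → ℕ → ℕ → ℚ → Set
x ≤ C · N ^ℚ r = x ℕ.^ ↧ₙ r ℕ.≤ C ℕ.^ ↧ₙ r ℕ.* N ℕ.^ ℤ.∣ ↥ r ∣

-- x ≤ C · N^(6 + ε) for real ε ≥ 0 and N ≥ 1, where N^(6 + ε) is the infimum of
-- the N^(6 + r) over the rationals r > ε.
_≤_·_^[6+_] : ℕ → ℕ → ℕ → ℝ → Set
x ≤ C · N ^[6+ ε ] = ∀ r → ℝ.Upper ε r → x ≤ C · N ^ℚ (ℤ→ℚ (ℤ.+ 6) ℚ.+ r)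

{-# OPTIONS --safe #-}

-- Moving a point of order 9 to the origin and computing its multiples puts E into
-- Kubert's form, which for the parameter m / n in lowest terms has an integral model
-- with a₄ = a₆ = 0 and a₂, a₃ divisible by m n (m - n) F, where F = m² - m n + n².
-- At every prime dividing m n (m - n), and at every prime other than 3 dividing F,
-- the model reduces to a node at the origin, so such a prime divides every minimal
-- discriminant and hence N.  As 2 divides m n (m - n) but not F, while 9 does not
-- divide F, having only two bad primes forces F = 3 and leaves (m , n) = (1 , 2),
-- (2 , 1) or (-1 , 1), with discriminant -2⁹ 3⁵, which is minimal because it has no
-- twelfth power as a divisor.  Moreover 3 divides c₄, so the reduction at 3 is not
-- a node; hence 18 divides N and |Δ| < 18⁵ ≤ N⁵.
module Submission where

open import Defs
open import Algebra.Bundles using (CommutativeRing; Semiring)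
import Algebra.Properties.CommutativeSemiring.Exp as Exp
import Algebra.Properties.Group as GroupProperties
open import Data.Empty using (⊥-elim)
open import Data.Fin.Patterns
open import Data.Integer.Base as ℤ using (ℤ; +_; -[1+_]; ∣_∣)
import Data.Integer.DivMod as ℤ
open import Data.Integer.Divisibility.Signed
  using (divides; ∣ᵤ⇒∣; ∣⇒∣ᵤ; ∣m∣n⇒∣m+n; ∣m∣n⇒∣m-n; ∣m⇒∣-m; ∣n⇒∣m*n; ∣m⇒∣m*n; *-cancelˡ-∣; ∣-trans; _∣?_)
  renaming (_∣_ to infix 4 _∣ᶻ_)
import Data.Integer.Properties as ℤ
open import Data.List.Base using (_∷_; [])
open import Data.List.Relation.Unary.All using (_∷_)
open import Data.Maybe.Base using (nothing)
open import Data.Nat.Base as ℕ using (ℕ; zero; suc; z≤n; s≤s; z<s)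
open import Data.Nat.Coprimality as ℕ using (Coprime)
import Data.Nat.Divisibility as ℕ
open import Data.Nat.Primality
  using (Prime; euclidsLemma; prime[2]; prime?; prime⇒irreducible; prime⇒nonTrivial)
open import Data.Nat.Primality.Factorisation using (factorise)
import Data.Nat.Properties as ℕ
open import Data.Product.Base using (_×_; _,_; proj₁; proj₂; ∃; ∃-syntax)
open import Data.Rational.Base as ℚ using (ℚ; 0ℚ; 1ℚ)
import Data.Rational.Properties as ℚ
import Data.Rational.Unnormalised.Base as ℚᵘ
import Data.Rational.Unnormalised.Properties as ℚᵘ
open import Data.Sum.Base using (_⊎_; inj₁; inj₂; [_,_]′)
open import Data.Unit.Base using (tt)
open import Data.Vec.Base as Vec using (Vec; []; _∷_)
open import Data.Vec.N-ary using (N-ary; Eq; curryⁿ; curryⁿ-cong; _$ⁿ_)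
open import Data.Vec.Properties using (lookup-map)
open import Function.Base using (_∘_)
open import Relation.Binary.PropositionalEquality
open import Relation.Nullary.Decidable using (Dec; yes; no; isYes; toWitness; from-yes; from-no)
open import Relation.Nullary.Negation using (¬_; contradiction)
open import Tactic.RingSolver.Core.AlmostCommutativeRing
  using (AlmostCommutativeRing; fromCommutativeRing; _-Raw-AlmostCommutative⟶_; -raw-almostCommutative⟶)
open import Tactic.RingSolver.Core.Expression
open import Tactic.RingSolver.Core.Polynomial.Parameters using (Homomorphism)

-- The minimal model in the hypotheses is abstract: it is integral with least |Δ|, and nothing else
-- is known of it. Divisibility facts about Kubert's model must therefore be carried over to it. Two
-- integral models of one curve satisfy i¹² Δ = j¹² Δ′ and i⁴ c₄ = j⁴ c₄′ with i and j coprime. A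
-- prime dividing Δ′ but not c₄′ then divides Δ, since otherwise it would divide i, hence not j,
-- hence c₄′. So a node persists in every integral model, which is why nodes are counted and not
-- prime divisors of one discriminant. The prime 3 escapes this count when it divides F: then it
-- divides a₁ too, and the reduction is a cusp.
--
-- The bound on F rests on a symmetry: F has the shape x² - xy + y² in any two of m, n, m - n, up to
-- sign. If a prime other than 3 divides F, then m, n and m - n, all prime to F, are powers of 2 up
-- to sign. Exactly one of them is even, so the other two are units and F is 1 or 3. Completing the
-- square in F leaves finitely many parameters, and f ≠ 0, 1 removes those with F = 1.

almostCommutativeRing : Ring → AlmostCommutativeRing _ _
almostCommutativeRing R = fromCommutativeRing R (λ _ → nothing)

-- The ring solver with integer coefficients: over ℚ these compute much faster
-- than rational ones.
module IntegerSolver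
  (R : Ring)
  (φ : CommutativeRing.rawRing ℤ-ring -Raw-AlmostCommutative⟶ almostCommutativeRing R)
  where

  private module R = CommutativeRing R
  open _-Raw-AlmostCommutative⟶_ φ renaming (⟦_⟧ to ⟦_⟧ᵣ)

  homo : Homomorphism _ _ _ _
  homo = record
    { from = record
      { rawRing = CommutativeRing.rawRing ℤ-ring
      ; isZero  = λ i → isYes (+ 0 ℤ.≟ i)
      }
    ; to = almostCommutativeRing R
    ; morphism = φ
    ; Zero-C⟶Zero-R = λ i z →
        R.trans (R.sym 0-homo) (R.reflexive (cong ⟦_⟧ᵣ (toWitness {a? = + 0 ℤ.≟ i} z)))
    }

  open Eval R.rawRing ⟦_⟧ᵣ public
  open import Algebra.Properties.Semiring.Exp.TCOptimised R.semiring using (^-congˡ)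
  open import Tactic.RingSolver.Core.Polynomial.Base (Homomorphism.from homo)
  open import Tactic.RingSolver.Core.Polynomial.Semantics homo renaming (⟦_⟧ to ⟦_⟧ₚ)
  open import Tactic.RingSolver.Core.Polynomial.Homomorphism homo

  norm : ∀ {n} → Expr ℤ n → Poly n
  norm (Κ x)   = κ x
  norm (Ι x)   = ι x
  norm (x ⊕ y) = norm x ⊞ norm y
  norm (x ⊗ y) = norm x ⊠ norm y
  norm (⊝ x)   = ⊟ norm x
  norm (x ⊛ i) = norm x ⊡ i

  norm-correct : ∀ {n} (e : Expr ℤ n) ρ → ⟦ norm e ⟧ₚ ρ R.≈ ⟦ e ⟧ ρ
  norm-correct (Κ x)   ρ = κ-hom x ρ
  norm-correct (Ι x)   ρ = ι-hom x ρ
  norm-correct (x ⊕ y) ρ =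
    R.trans (⊞-hom (norm x) (norm y) ρ) (R.+-cong (norm-correct x ρ) (norm-correct y ρ))
  norm-correct (x ⊗ y) ρ =
    R.trans (⊠-hom (norm x) (norm y) ρ) (R.*-cong (norm-correct x ρ) (norm-correct y ρ))
  norm-correct (⊝ x)   ρ = R.trans (⊟-hom (norm x) ρ) (R.-‿cong (norm-correct x ρ))
  norm-correct (x ⊛ i) ρ = R.trans (⊡-hom (norm x) i ρ) (^-congˡ i (norm-correct x ρ))

  -- The hypothesis compares normal forms, so `refl` at a use site is a computation with integer
  -- coefficients only, whatever the ring `R` is.
  solve : ∀ n (f : N-ary n (Expr ℤ n) (Expr ℤ n × Expr ℤ n)) →
          (let l , r = f $ⁿ Vec.map Ι (Vec.allFin n)) →
          norm l ≡ norm r → Eq n R._≈_ (curryⁿ ⟦ l ⟧) (curryⁿ ⟦ r ⟧)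
  solve n f eq = curryⁿ-cong R._≈_ ⟦ l ⟧ ⟦ r ⟧ λ ρ →
    R.trans (R.sym (norm-correct l ρ))
      (R.trans (R.reflexive (cong (λ p → ⟦ p ⟧ₚ ρ) eq)) (norm-correct r ρ))
    where
    l = proj₁ (f $ⁿ Vec.map Ι (Vec.allFin n))
    r = proj₂ (f $ⁿ Vec.map Ι (Vec.allFin n))

infixl 6 _⊖_
infix  4 _⊜_

_⊖_ : ∀ {n} → Expr ℤ n → Expr ℤ n → Expr ℤ n
x ⊖ y = x ⊕ ⊝ y

_⊜_ : ∀ {n} → Expr ℤ n → Expr ℤ n → Expr ℤ n × Expr ℤ n
_⊜_ = _,_

-- These unfold in the same way as the multiples and powers in Defs.
infixr 8 _·ᴱ_ _^ᴱ_

_·ᴱ_ : ∀ {n} → ℕ → Expr ℤ n → Expr ℤ n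
zero  ·ᴱ x = Κ (+ 0)
suc k ·ᴱ x = x ⊕ k ·ᴱ x

_^ᴱ_ : ∀ {n} → Expr ℤ n → ℕ → Expr ℤ n
x ^ᴱ zero  = Κ (+ 1)
x ^ᴱ suc k = x ⊗ x ^ᴱ k

-- The embedding of ℤ in ℚ.

private
  toℚᵘ-ℤ→ℚ : ∀ i → ℚ.toℚᵘ (ℤ→ℚ i) ℚᵘ.≃ ℚᵘ.mkℚᵘ i 0
  toℚᵘ-ℤ→ℚ i = ℚ.toℚᵘ-fromℚᵘ (ℚᵘ.mkℚᵘ i 0)

ℤ→ℚ-+ : ∀ i j → ℤ→ℚ (i ℤ.+ j) ≡ ℤ→ℚ i ℚ.+ ℤ→ℚ j
ℤ→ℚ-+ i j = ℚ.toℚᵘ-injective (begin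
  ℚ.toℚᵘ (ℤ→ℚ (i ℤ.+ j))                  ≈⟨ toℚᵘ-ℤ→ℚ (i ℤ.+ j) ⟩
  ℚᵘ.mkℚᵘ (i ℤ.+ j) 0                      ≡⟨ cong₂ (λ a b → ℚᵘ.mkℚᵘ (a ℤ.+ b) 0) (ℤ.*-identityʳ i) (ℤ.*-identityʳ j) ⟨
  ℚᵘ.mkℚᵘ i 0 ℚᵘ.+ ℚᵘ.mkℚᵘ j 0             ≈⟨ ℚᵘ.+-cong (toℚᵘ-ℤ→ℚ i) (toℚᵘ-ℤ→ℚ j) ⟨
  ℚ.toℚᵘ (ℤ→ℚ i) ℚᵘ.+ ℚ.toℚᵘ (ℤ→ℚ j)       ≈⟨ ℚ.toℚᵘ-homo-+ (ℤ→ℚ i) (ℤ→ℚ j) ⟨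
  ℚ.toℚᵘ (ℤ→ℚ i ℚ.+ ℤ→ℚ j)                 ∎)
  where open ℚᵘ.≃-Reasoning

ℤ→ℚ-* : ∀ i j → ℤ→ℚ (i ℤ.* j) ≡ ℤ→ℚ i ℚ.* ℤ→ℚ j
ℤ→ℚ-* i j = ℚ.toℚᵘ-injective (begin
  ℚ.toℚᵘ (ℤ→ℚ (i ℤ.* j))                  ≈⟨ toℚᵘ-ℤ→ℚ (i ℤ.* j) ⟩
  ℚᵘ.mkℚᵘ i 0 ℚᵘ.* ℚᵘ.mkℚᵘ j 0             ≈⟨ ℚᵘ.*-cong (toℚᵘ-ℤ→ℚ i) (toℚᵘ-ℤ→ℚ j) ⟨
  ℚ.toℚᵘ (ℤ→ℚ i) ℚᵘ.* ℚ.toℚᵘ (ℤ→ℚ j)       ≈⟨ ℚ.toℚᵘ-homo-* (ℤ→ℚ i) (ℤ→ℚ j) ⟨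
  ℚ.toℚᵘ (ℤ→ℚ i ℚ.* ℤ→ℚ j)                 ∎)
  where open ℚᵘ.≃-Reasoning

ℤ→ℚ-neg : ∀ i → ℤ→ℚ (ℤ.- i) ≡ ℚ.- ℤ→ℚ i
ℤ→ℚ-neg i = ℚ.toℚᵘ-injective (begin
  ℚ.toℚᵘ (ℤ→ℚ (ℤ.- i))    ≈⟨ toℚᵘ-ℤ→ℚ (ℤ.- i) ⟩
  ℚᵘ.- ℚᵘ.mkℚᵘ i 0         ≈⟨ ℚᵘ.-‿cong (toℚᵘ-ℤ→ℚ i) ⟨
  ℚᵘ.- ℚ.toℚᵘ (ℤ→ℚ i)      ≈⟨ ℚ.toℚᵘ-homo‿- (ℤ→ℚ i) ⟨
  ℚ.toℚᵘ (ℚ.- ℤ→ℚ i)       ∎)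
  where open ℚᵘ.≃-Reasoning

ℤ→ℚ-injective : ∀ {i j} → ℤ→ℚ i ≡ ℤ→ℚ j → i ≡ j
ℤ→ℚ-injective {i} {j} eq =
  trans (sym (ℤ.*-identityʳ i)) (trans (ℚᵘ.drop-*≡* i≃j) (ℤ.*-identityʳ j))
  where
  i≃j : ℚᵘ.mkℚᵘ i 0 ℚᵘ.≃ ℚᵘ.mkℚᵘ j 0
  i≃j = ℚᵘ.≃-trans (ℚᵘ.≃-sym (toℚᵘ-ℤ→ℚ i)) (ℚᵘ.≃-trans (ℚᵘ.≃-reflexive (cong ℚ.toℚᵘ eq)) (toℚᵘ-ℤ→ℚ j))

ℤ→ℚ-homomorphism : CommutativeRing.rawRing ℤ-ring -Raw-AlmostCommutative⟶ almostCommutativeRing ℚ-ring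
ℤ→ℚ-homomorphism = record
  { ⟦_⟧ = ℤ→ℚ ; +-homo = ℤ→ℚ-+ ; *-homo = ℤ→ℚ-* ; -‿homo = ℤ→ℚ-neg ; 0-homo = refl ; 1-homo = refl }

ℤ-homomorphism : CommutativeRing.rawRing ℤ-ring -Raw-AlmostCommutative⟶ almostCommutativeRing ℤ-ring
ℤ-homomorphism = -raw-almostCommutative⟶ (almostCommutativeRing ℤ-ring)

module ℚ-Solver = IntegerSolver ℚ-ring ℤ→ℚ-homomorphism
module ℤ-Solver = IntegerSolver ℤ-ring ℤ-homomorphism

-- A single induction on expressions replaces separate computations for Δ, c₄ and the coefficients
-- of `integralModel`, all of which are values of integer polynomials.
ℤ→ℚ-⟦⟧ : ∀ {n} (e : Expr ℤ n) ρ → ℤ→ℚ (ℤ-Solver.⟦ e ⟧ ρ) ≡ ℚ-Solver.⟦ e ⟧ (Vec.map ℤ→ℚ ρ)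
ℤ→ℚ-⟦⟧ (Κ x)   ρ = refl
ℤ→ℚ-⟦⟧ (Ι x)   ρ = sym (lookup-map x ℤ→ℚ ρ)
ℤ→ℚ-⟦⟧ (x ⊕ y) ρ =
  trans (ℤ→ℚ-+ (ℤ-Solver.⟦ x ⟧ ρ) (ℤ-Solver.⟦ y ⟧ ρ)) (cong₂ ℚ._+_ (ℤ→ℚ-⟦⟧ x ρ) (ℤ→ℚ-⟦⟧ y ρ))
ℤ→ℚ-⟦⟧ (x ⊗ y) ρ =
  trans (ℤ→ℚ-* (ℤ-Solver.⟦ x ⟧ ρ) (ℤ-Solver.⟦ y ⟧ ρ)) (cong₂ ℚ._*_ (ℤ→ℚ-⟦⟧ x ρ) (ℤ→ℚ-⟦⟧ y ρ))
ℤ→ℚ-⟦⟧ (⊝ x)   ρ = trans (ℤ→ℚ-neg (ℤ-Solver.⟦ x ⟧ ρ)) (cong ℚ.-_ (ℤ→ℚ-⟦⟧ x ρ))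
ℤ→ℚ-⟦⟧ (x ⊛ zero)        ρ = refl
ℤ→ℚ-⟦⟧ (x ⊛ suc zero)    ρ = ℤ→ℚ-⟦⟧ x ρ
ℤ→ℚ-⟦⟧ (x ⊛ suc (suc i)) ρ =
  trans (ℤ→ℚ-* (ℤ-Solver.⟦ x ⊛ suc i ⟧ ρ) (ℤ-Solver.⟦ x ⟧ ρ))
        (cong₂ ℚ._*_ (ℤ→ℚ-⟦⟧ (x ⊛ suc i) ρ) (ℤ→ℚ-⟦⟧ x ρ))

-- Invariants of Weierstrass equations.

c₄ : (R : Ring) → Weierstrass (CommutativeRing.Carrier R) → CommutativeRing.Carrier R
c₄ R W = b₂ ^ᴿ 2 - 24 ·ᴿ b₄
  where
  open CommutativeRing R using (_-_) renaming (semiring to R-semiring)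
  open import Algebra.Definitions.RawSemiring (Semiring.rawSemiring R-semiring)
    renaming (_×_ to infixr 8 _·ᴿ_; _^_ to _^ᴿ_)
  open WeierstrassOver R W

module WeierstrassExpr {n} (W : Weierstrass (Expr ℤ n)) where
  open Weierstrass W
  b₂ᴱ b₄ᴱ b₆ᴱ b₈ᴱ Δᴱ c₄ᴱ : Expr ℤ n
  b₂ᴱ = a₁ ^ᴱ 2 ⊕ 4 ·ᴱ a₂
  b₄ᴱ = 2 ·ᴱ a₄ ⊕ a₁ ⊗ a₃
  b₆ᴱ = a₃ ^ᴱ 2 ⊕ 4 ·ᴱ a₆
  b₈ᴱ = a₁ ^ᴱ 2 ⊗ a₆ ⊕ 4 ·ᴱ (a₂ ⊗ a₆) ⊖ a₁ ⊗ a₃ ⊗ a₄ ⊕ a₂ ⊗ a₃ ^ᴱ 2 ⊖ a₄ ^ᴱ 2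
  Δᴱ  = 9 ·ᴱ (b₂ᴱ ⊗ b₄ᴱ ⊗ b₆ᴱ) ⊖ b₂ᴱ ^ᴱ 2 ⊗ b₈ᴱ ⊖ 8 ·ᴱ b₄ᴱ ^ᴱ 3 ⊖ 27 ·ᴱ b₆ᴱ ^ᴱ 2
  c₄ᴱ = b₂ᴱ ^ᴱ 2 ⊖ 24 ·ᴱ b₄ᴱ

open WeierstrassExpr using (Δᴱ; c₄ᴱ)

coefficients : ∀ {A : Set} → Weierstrass A → Vec A 5
coefficients (weierstrass a₁ a₂ a₃ a₄ a₆) = a₁ ∷ a₂ ∷ a₃ ∷ a₄ ∷ a₆ ∷ []

generic : Weierstrass (Expr ℤ 5)
generic = weierstrass (Ι 0F) (Ι 1F) (Ι 2F) (Ι 3F) (Ι 4F)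

Δ-mapW : ∀ W → ℤ→ℚ (WeierstrassOver.Δ ℤ-ring W) ≡ WeierstrassOver.Δ ℚ-ring (mapW ℤ→ℚ W)
Δ-mapW W = ℤ→ℚ-⟦⟧ (Δᴱ generic) (coefficients W)

c₄-mapW : ∀ W → ℤ→ℚ (c₄ ℤ-ring W) ≡ c₄ ℚ-ring (mapW ℤ→ℚ W)
c₄-mapW W = ℤ→ℚ-⟦⟧ (c₄ᴱ generic) (coefficients W)

-- Changes of coordinates over ℚ.

module OverRationals where
  open CommutativeRing ℚ-ring using (_+_; _-_; -_; _*_; semiring; +-group)
  open import Algebra.Definitions.RawSemiring (Semiring.rawSemiring semiring) using (_^_)
    renaming (_×_ to infixr 8 _·_)
  open Exp (CommutativeRing.commutativeSemiring ℚ-ring) using (^-distrib-*)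
  open ℚ-Solver using (solve)

  scale : ℚ → Weierstrass ℚ → Weierstrass ℚ
  scale u (weierstrass a₁ a₂ a₃ a₄ a₆) =
    weierstrass (u * a₁) (u ^ 2 * a₂) (u ^ 3 * a₃) (u ^ 4 * a₄) (u ^ 6 * a₆)

  translate : ℚ → ℚ → ℚ → Weierstrass ℚ → Weierstrass ℚ
  translate r s t (weierstrass a₁ a₂ a₃ a₄ a₆) = weierstrass
    (a₁ + 2 · s)
    (a₂ - s * a₁ + 3 · r - s ^ 2)
    (a₃ + r * a₁ + 2 · t)
    (a₄ - s * a₃ + 2 · (r * a₂) - (t + r * s) * a₁ + 3 · r ^ 2 - 2 · (s * t))
    (a₆ + r * a₄ + r ^ 2 * a₂ + r ^ 3 - t * a₃ - t ^ 2 - r * t * a₁)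

  scaleᴱ : ∀ {n} → Expr ℤ n → Weierstrass (Expr ℤ n) → Weierstrass (Expr ℤ n)
  scaleᴱ u (weierstrass a₁ a₂ a₃ a₄ a₆) =
    weierstrass (u ⊗ a₁) (u ^ᴱ 2 ⊗ a₂) (u ^ᴱ 3 ⊗ a₃) (u ^ᴱ 4 ⊗ a₄) (u ^ᴱ 6 ⊗ a₆)

  translateᴱ : ∀ {n} → Expr ℤ n → Expr ℤ n → Expr ℤ n → Weierstrass (Expr ℤ n) → Weierstrass (Expr ℤ n)
  translateᴱ r s t (weierstrass a₁ a₂ a₃ a₄ a₆) = weierstrass
    (a₁ ⊕ 2 ·ᴱ s)
    (a₂ ⊖ s ⊗ a₁ ⊕ 3 ·ᴱ r ⊖ s ^ᴱ 2)
    (a₃ ⊕ r ⊗ a₁ ⊕ 2 ·ᴱ t)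
    (a₄ ⊖ s ⊗ a₃ ⊕ 2 ·ᴱ (r ⊗ a₂) ⊖ (t ⊕ r ⊗ s) ⊗ a₁ ⊕ 3 ·ᴱ r ^ᴱ 2 ⊖ 2 ·ᴱ (s ⊗ t))
    (a₆ ⊕ r ⊗ a₄ ⊕ r ^ᴱ 2 ⊗ a₂ ⊕ r ^ᴱ 3 ⊖ t ⊗ a₃ ⊖ t ^ᴱ 2 ⊖ r ⊗ t ⊗ a₁)

  Δ-scale : ∀ u W → WeierstrassOver.Δ ℚ-ring (scale u W) ≡ u ^ 12 * WeierstrassOver.Δ ℚ-ring W
  Δ-scale u (weierstrass a₁ a₂ a₃ a₄ a₆) = ℚ-Solver.solve 6
    (λ u a₁ a₂ a₃ a₄ a₆ → let W = weierstrass a₁ a₂ a₃ a₄ a₆ in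
      Δᴱ (scaleᴱ u W) ⊜ u ^ᴱ 12 ⊗ Δᴱ W) refl u a₁ a₂ a₃ a₄ a₆

  c₄-scale : ∀ u W → c₄ ℚ-ring (scale u W) ≡ u ^ 4 * c₄ ℚ-ring W
  c₄-scale u (weierstrass a₁ a₂ a₃ a₄ a₆) = ℚ-Solver.solve 6
    (λ u a₁ a₂ a₃ a₄ a₆ → let W = weierstrass a₁ a₂ a₃ a₄ a₆ in
      c₄ᴱ (scaleᴱ u W) ⊜ u ^ᴱ 4 ⊗ c₄ᴱ W) refl u a₁ a₂ a₃ a₄ a₆

  Δ-translate : ∀ r s t W →
    WeierstrassOver.Δ ℚ-ring (translate r s t W) ≡ WeierstrassOver.Δ ℚ-ring W
  Δ-translate r s t (weierstrass a₁ a₂ a₃ a₄ a₆) = ℚ-Solver.solve 8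
    (λ r s t a₁ a₂ a₃ a₄ a₆ → let W = weierstrass a₁ a₂ a₃ a₄ a₆ in
      Δᴱ (translateᴱ r s t W) ⊜ Δᴱ W) refl r s t a₁ a₂ a₃ a₄ a₆

  c₄-translate : ∀ r s t W → c₄ ℚ-ring (translate r s t W) ≡ c₄ ℚ-ring W
  c₄-translate r s t (weierstrass a₁ a₂ a₃ a₄ a₆) = ℚ-Solver.solve 8
    (λ r s t a₁ a₂ a₃ a₄ a₆ → let W = weierstrass a₁ a₂ a₃ a₄ a₆ in
      c₄ᴱ (translateᴱ r s t W) ⊜ c₄ᴱ W) refl r s t a₁ a₂ a₃ a₄ a₆

  weierstrass-cong : ∀ {A : Set} {a₁ a₂ a₃ a₄ a₆ b₁ b₂ b₃ b₄ b₆ : A} →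
    a₁ ≡ b₁ → a₂ ≡ b₂ → a₃ ≡ b₃ → a₄ ≡ b₄ → a₆ ≡ b₆ →
    weierstrass a₁ a₂ a₃ a₄ a₆ ≡ weierstrass b₁ b₂ b₃ b₄ b₆
  weierstrass-cong refl refl refl refl refl = refl

  -- The equations of `_≅_` contain no division, so an isomorphism splits into a scaling of the
  -- target and a translation of the source. The invariants need to be followed only through these
  -- two.
  ≅⇒scale≡translate : ∀ W W′ ((u , r , s , t , _) : W ≅ W′) → scale u W′ ≡ translate r s t W
  ≅⇒scale≡translate (weierstrass _ _ _ _ _) (weierstrass _ _ _ _ _) (u , r , s , t , _ , e₁ , e₂ , e₃ , e₄ , e₆) =
    weierstrass-cong e₁ e₂ e₃ e₄ e₆

  Δ-≅ : ∀ W W′ ((u , _) : W ≅ W′) →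
    u ^ 12 * WeierstrassOver.Δ ℚ-ring W′ ≡ WeierstrassOver.Δ ℚ-ring W
  Δ-≅ W W′ iso@(u , r , s , t , _) =
    trans (sym (Δ-scale u W′))
      (trans (cong (WeierstrassOver.Δ ℚ-ring) (≅⇒scale≡translate W W′ iso)) (Δ-translate r s t W))

  c₄-≅ : ∀ W W′ ((u , _) : W ≅ W′) → u ^ 4 * c₄ ℚ-ring W′ ≡ c₄ ℚ-ring W
  c₄-≅ W W′ iso@(u , r , s , t , _) =
    trans (sym (c₄-scale u W′))
      (trans (cong (c₄ ℚ-ring) (≅⇒scale≡translate W W′ iso)) (c₄-translate r s t W))

  inverse : ∀ {q} → q ≢ 0ℚ → ∃[ q⁻¹ ] q * q⁻¹ ≡ 1ℚ
  inverse {q} q≢0 = ℚ.1/ q , ℚ.*-inverseʳ q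
    where instance _ = ℚ.≢-nonZero q≢0

  *-cancelˡ-0 : ∀ {p q} → p ≢ 0ℚ → p * q ≡ 0ℚ → q ≡ 0ℚ
  *-cancelˡ-0 {p} {q} p≢0 pq≡0 = let p⁻¹ , p*p⁻¹≡1 = inverse p≢0 in begin
    q               ≡⟨ ℚ.*-identityˡ q ⟨
    1ℚ * q          ≡⟨ cong (_* q) p*p⁻¹≡1 ⟨
    p * p⁻¹ * q     ≡⟨ solve 3 (λ p p⁻¹ q → p ⊗ p⁻¹ ⊗ q ⊜ p⁻¹ ⊗ (p ⊗ q)) refl p p⁻¹ q ⟩
    p⁻¹ * (p * q)   ≡⟨ cong (p⁻¹ *_) pq≡0 ⟩
    p⁻¹ * 0ℚ        ≡⟨ ℚ.*-zeroʳ p⁻¹ ⟩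
    0ℚ              ∎
    where open ≡-Reasoning

  *-≢0 : ∀ {p q} → p ≢ 0ℚ → q ≢ 0ℚ → p * q ≢ 0ℚ
  *-≢0 p≢0 q≢0 pq≡0 = q≢0 (*-cancelˡ-0 p≢0 pq≡0)

  ≡⇒-≡0 : ∀ {l r} → l ≡ r → l - r ≡ 0ℚ
  ≡⇒-≡0 {l} refl = ℚ.+-inverseʳ l

  -≡0⇒≡ : ∀ {l r} → l - r ≡ 0ℚ → l ≡ r
  -≡0⇒≡ = GroupProperties.x∙y⁻¹≈ε⇒x≈y +-group _ _

  -- An equation is deduced from others by exhibiting the difference of its
  -- sides as a linear combination z of the differences of theirs.
  infixr 7 _∙_
  infixl 6 _⊹_

  _∙_ : ∀ c {l r} → l ≡ r → c * (l - r) ≡ 0ℚ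
  c ∙ eq = trans (cong (c *_) (≡⇒-≡0 eq)) (ℚ.*-zeroʳ c)

  _⊹_ : ∀ {x y} → x ≡ 0ℚ → y ≡ 0ℚ → x + y ≡ 0ℚ
  refl ⊹ refl = refl

  combine : ∀ {l r z} → l - r ≡ z → z ≡ 0ℚ → l ≡ r
  combine eq z≡0 = -≡0⇒≡ (trans eq z≡0)

  combine/ : ∀ {k l r z} → k ≢ 0ℚ → k * (l - r) ≡ z → z ≡ 0ℚ → l ≡ r
  combine/ k≢0 eq z≡0 = -≡0⇒≡ (*-cancelˡ-0 k≢0 (trans eq z≡0))

  -- Tate normal form and the multiples of (0 , 0).

  tateForm : ℚ → ℚ → Weierstrass ℚ
  tateForm b c = weierstrass (1ℚ - c) (- b) (- b) 0ℚ 0ℚ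

  -- (X′ , Y′) = (X , Y) + (0 , 0) on the curve tateForm b c, in coordinates; the
  -- tangent at (0 , 0) has slope 0.
  record Step (b c X Y X′ Y′ : ℚ) : Set where
    constructor step
    field
      slope   : ℚ
      line    : Y ≡ slope * X
      X-eq    : X′ ≡ slope ^ 2 + (1ℚ - c) * slope + b - X
      Y-eq    : Y′ ≡ - (slope + (1ℚ - c)) * X′ + b
      horizontal : X ≡ 0ℚ → slope ≡ 0ℚ

  -- (0 , 0) generates a subgroup of order 9: the multiples 2P, 3P, 4P are computed
  -- upwards and 8P, 7P, 6P, 5P downwards, and then 4P + P = 5P is a condition on b, c.
  module _ {b c : ℚ} (b≢0 : b ≢ 0ℚ) where

    -- Only X ≡ 0 is assumed, so that this serves both to compute 2P and to exclude X₇ ≡ 0 further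
    -- down.
    step-0 : ∀ {X Y X′ Y′} → X ≡ 0ℚ → Step b c X Y X′ Y′ → X′ ≡ b × Y′ ≡ b * c
    step-0 {X} {Y} {X′} {Y′} X≡0 (step Λ _ X-eq Y-eq horizontal) = X′≡b , Y′≡bc
      where
      X′≡b : X′ ≡ b
      X′≡b = combine (solve 5 (λ b c Λ X X′ → X′ ⊖ b ⊜
          Κ (+ 1) ⊗ (X′ ⊖ (Λ ^ᴱ 2 ⊕ (Κ (+ 1) ⊖ c) ⊗ Λ ⊕ b ⊖ X))
          ⊕ (Λ ⊕ (Κ (+ 1) ⊖ c)) ⊗ (Λ ⊖ Κ (+ 0)) ⊕ (⊝ Κ (+ 1)) ⊗ (X ⊖ Κ (+ 0))) refl b c Λ X X′)
        (1ℚ ∙ X-eq ⊹ (Λ + (1ℚ - c)) ∙ horizontal X≡0 ⊹ (- 1ℚ) ∙ X≡0)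
      Y′≡bc : Y′ ≡ b * c
      Y′≡bc = combine (solve 5 (λ b c Λ X′ Y′ → Y′ ⊖ b ⊗ c ⊜
          Κ (+ 1) ⊗ (Y′ ⊖ ((⊝ (Λ ⊕ (Κ (+ 1) ⊖ c))) ⊗ X′ ⊕ b))
          ⊕ (⊝ X′) ⊗ (Λ ⊖ Κ (+ 0))
          ⊕ (⊝ (Κ (+ 1) ⊖ c)) ⊗ (X′ ⊖ b)) refl b c Λ X′ Y′)
        (1ℚ ∙ Y-eq ⊹ (- X′) ∙ horizontal X≡0 ⊹ (- (1ℚ - c)) ∙ X′≡b)

    step-2P : ∀ {X′ Y′} → Step b c b (b * c) X′ Y′ → X′ ≡ c × Y′ ≡ b - c
    step-2P {X′} {Y′} (step Λ line X-eq Y-eq _) = X′≡c , Y′≡b-c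
      where
      Λ≡c : Λ ≡ c
      Λ≡c = combine/ b≢0
        (solve 3 (λ b c Λ → b ⊗ (Λ ⊖ c) ⊜ (⊝ Κ (+ 1)) ⊗ (b ⊗ c ⊖ Λ ⊗ b)) refl b c Λ) ((- 1ℚ) ∙ line)
      X′≡c : X′ ≡ c
      X′≡c = combine (solve 4 (λ b c Λ X′ → X′ ⊖ c ⊜
          Κ (+ 1) ⊗ (X′ ⊖ (Λ ^ᴱ 2 ⊕ (Κ (+ 1) ⊖ c) ⊗ Λ ⊕ b ⊖ b)) ⊕ (Λ ⊕ Κ (+ 1)) ⊗ (Λ ⊖ c)) refl b c Λ X′)
        (1ℚ ∙ X-eq ⊹ (Λ + 1ℚ) ∙ Λ≡c)
      Y′≡b-c : Y′ ≡ b - c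
      Y′≡b-c = combine (solve 5 (λ b c Λ X′ Y′ → Y′ ⊖ (b ⊖ c) ⊜
          Κ (+ 1) ⊗ (Y′ ⊖ ((⊝ (Λ ⊕ (Κ (+ 1) ⊖ c))) ⊗ X′ ⊕ b))
          ⊕ (⊝ X′) ⊗ (Λ ⊖ c) ⊕ (⊝ Κ (+ 1)) ⊗ (X′ ⊖ c)) refl b c Λ X′ Y′)
        (1ℚ ∙ Y-eq ⊹ (- X′) ∙ Λ≡c ⊹ (- 1ℚ) ∙ X′≡c)

    module _ {X₄ Y₄} (3P+P≡4P : Step b c c (b - c) X₄ Y₄) where
      open Step 3P+P≡4P using () renaming (slope to e; line to line₃; X-eq to X₄-eq; Y-eq to Y₄-eq)

      -- For c = 0 the point 3P would be (0 , b) = -P, and the order would be 4.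
      c≢0 : c ≢ 0ℚ
      c≢0 c≡0 = b≢0 (combine (solve 3 (λ b c e → b ⊖ Κ (+ 0) ⊜
        Κ (+ 1) ⊗ (b ⊖ c ⊖ e ⊗ c) ⊕ (e ⊕ Κ (+ 1)) ⊗ (c ⊖ Κ (+ 0))) refl b c e)
        (1ℚ ∙ line₃ ⊹ (e + 1ℚ) ∙ c≡0))

      b-eq : b ≡ c * (e + 1ℚ)
      b-eq = combine (solve 3 (λ b c e → b ⊖ c ⊗ (e ⊕ Κ (+ 1)) ⊜
        Κ (+ 1) ⊗ (b ⊖ c ⊖ e ⊗ c)) refl b c e) (1ℚ ∙ line₃)

      X₄≡ : X₄ ≡ e * (e + 1ℚ)
      X₄≡ = combine (solve 4 (λ b c e X₄ → X₄ ⊖ e ⊗ (e ⊕ Κ (+ 1)) ⊜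
        Κ (+ 1) ⊗ (X₄ ⊖ (e ^ᴱ 2 ⊕ (Κ (+ 1) ⊖ c) ⊗ e ⊕ b ⊖ c)) ⊕ Κ (+ 1) ⊗ (b ⊖ c ⊗ (e ⊕ Κ (+ 1)))) refl b c e X₄)
        (1ℚ ∙ X₄-eq ⊹ 1ℚ ∙ b-eq)

      module _ {X₅ Y₅ X₆ Y₆ X₇ Y₇ X₈ Y₈}
        (4P+P≡5P : Step b c X₄ Y₄ X₅ Y₅) (5P+P≡6P : Step b c X₅ Y₅ X₆ Y₆)
        (6P+P≡7P : Step b c X₆ Y₆ X₇ Y₇) (7P+P≡8P : Step b c X₇ Y₇ X₈ Y₈)
        (curve₇ : Y₇ ^ 2 + (1ℚ - c) * X₇ * Y₇ - b * Y₇ ≡ X₇ ^ 3 - b * X₇ ^ 2)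
        (X₈≡0 : X₈ ≡ 0ℚ) where
        open Step 4P+P≡5P using () renaming (slope to Λ₄; line to line₄; X-eq to X₅-eq)
        open Step 5P+P≡6P using () renaming (slope to Λ₅; X-eq to X₆-eq; Y-eq to Y₆-eq)
        open Step 6P+P≡7P using () renaming (slope to Λ₆; line to line₆; X-eq to X₇-eq; Y-eq to Y₇-eq)
        open Step 7P+P≡8P using () renaming (slope to Λ₇; line to line₇; X-eq to X₈-eq)

        X₇≢0 : X₇ ≢ 0ℚ
        X₇≢0 X₇≡0 = b≢0 (trans (sym (proj₁ (step-0 X₇≡0 7P+P≡8P))) X₈≡0)

        -- The line through P and 7P meets the curve again in -8P = P, so it is the tangent at P. As
        -- only X₈ ≡ 0 is given, the equation of the curve at 7P is brought in: compared with X₇² X₈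
        -- ≡ 0 it leaves b Y₇ ≡ 0.
        Λ₇≡0 : Λ₇ ≡ 0ℚ
        Λ₇≡0 = combine/ (*-≢0 b≢0 X₇≢0) (solve 6 (λ b c Λ X Y X₈ →
          (b ⊗ X) ⊗ (Λ ⊖ Κ (+ 0)) ⊜
          (Y ⊕ Λ ⊗ X ⊕ (Κ (+ 1) ⊖ c) ⊗ X ⊖ b) ⊗ (Y ⊖ Λ ⊗ X)
          ⊕ (⊝ Κ (+ 1)) ⊗ (Y ^ᴱ 2 ⊕ (Κ (+ 1) ⊖ c) ⊗ X ⊗ Y ⊖ b ⊗ Y ⊖ (X ^ᴱ 3 ⊖ b ⊗ X ^ᴱ 2))
          ⊕ (⊝ X ^ᴱ 2) ⊗ (X₈ ⊖ (Λ ^ᴱ 2 ⊕ (Κ (+ 1) ⊖ c) ⊗ Λ ⊕ b ⊖ X))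
          ⊕ X ^ᴱ 2 ⊗ (X₈ ⊖ Κ (+ 0)))
          refl b c Λ₇ X₇ Y₇ X₈)
          ((Y₇ + Λ₇ * X₇ + (1ℚ - c) * X₇ - b) ∙ line₇ ⊹ (- 1ℚ) ∙ curve₇ ⊹ (- (X₇ ^ 2)) ∙ X₈-eq ⊹ (X₇ ^ 2) ∙ X₈≡0)

        X₇≡b : X₇ ≡ b
        X₇≡b = combine (solve 5 (λ b c Λ X X₈ → X ⊖ b ⊜
          Κ (+ 1) ⊗ (X₈ ⊖ (Λ ^ᴱ 2 ⊕ (Κ (+ 1) ⊖ c) ⊗ Λ ⊕ b ⊖ X))
          ⊕ (⊝ Κ (+ 1)) ⊗ (X₈ ⊖ Κ (+ 0)) ⊕ (Λ ⊕ (Κ (+ 1) ⊖ c)) ⊗ (Λ ⊖ Κ (+ 0))) refl b c Λ₇ X₇ X₈)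
          (1ℚ ∙ X₈-eq ⊹ (- 1ℚ) ∙ X₈≡0 ⊹ (Λ₇ + (1ℚ - c)) ∙ Λ₇≡0)

        -- Since P + 2P + 6P = 𝒪, the line through P and 6P is the one through P and 2P, whose slope
        -- was c. In the same way the line through P and 5P is the one through P and 3P, of slope e.
        Λ₆≡c : Λ₆ ≡ c
        Λ₆≡c = combine/ b≢0 (solve 6 (λ b c Λ₆ Λ₇ X₇ Y₇ → b ⊗ (Λ₆ ⊖ c) ⊜
          Κ (+ 1) ⊗ (Y₇ ⊖ ((⊝ (Λ₆ ⊕ (Κ (+ 1) ⊖ c))) ⊗ X₇ ⊕ b))
          ⊕ (⊝ Κ (+ 1)) ⊗ (Y₇ ⊖ Λ₇ ⊗ X₇)
          ⊕ (⊝ X₇) ⊗ (Λ₇ ⊖ Κ (+ 0))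
          ⊕ (⊝ (Λ₆ ⊕ (Κ (+ 1) ⊖ c))) ⊗ (X₇ ⊖ b)) refl b c Λ₆ Λ₇ X₇ Y₇)
          (1ℚ ∙ Y₇-eq ⊹ (- 1ℚ) ∙ line₇ ⊹ (- X₇) ∙ Λ₇≡0 ⊹ (- (Λ₆ + (1ℚ - c))) ∙ X₇≡b)

        X₆≡c : X₆ ≡ c
        X₆≡c = combine (solve 5 (λ b c Λ₆ X₆ X₇ → X₆ ⊖ c ⊜
          Κ (+ 1) ⊗ (X₇ ⊖ (Λ₆ ^ᴱ 2 ⊕ (Κ (+ 1) ⊖ c) ⊗ Λ₆ ⊕ b ⊖ X₆))
          ⊕ (⊝ Κ (+ 1)) ⊗ (X₇ ⊖ b) ⊕ (Λ₆ ⊕ Κ (+ 1)) ⊗ (Λ₆ ⊖ c)) refl b c Λ₆ X₆ X₇)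
          (1ℚ ∙ X₇-eq ⊹ (- 1ℚ) ∙ X₇≡b ⊹ (Λ₆ + 1ℚ) ∙ Λ₆≡c)

        Λ₅≡e : Λ₅ ≡ e
        Λ₅≡e = combine/ c≢0 (solve 7 (λ b c e Λ₅ Λ₆ X₆ Y₆ → c ⊗ (Λ₅ ⊖ e) ⊜
          Κ (+ 1) ⊗ (Y₆ ⊖ ((⊝ (Λ₅ ⊕ (Κ (+ 1) ⊖ c))) ⊗ X₆ ⊕ b))
          ⊕ (⊝ Κ (+ 1)) ⊗ (Y₆ ⊖ Λ₆ ⊗ X₆)
          ⊕ (⊝ X₆) ⊗ (Λ₆ ⊖ c)
          ⊕ (⊝ (Λ₅ ⊕ Κ (+ 1))) ⊗ (X₆ ⊖ c)
          ⊕ Κ (+ 1) ⊗ (b ⊖ c ⊗ (e ⊕ Κ (+ 1)))) refl b c e Λ₅ Λ₆ X₆ Y₆)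
          (1ℚ ∙ Y₆-eq ⊹ (- 1ℚ) ∙ line₆ ⊹ (- X₆) ∙ Λ₆≡c ⊹ (- (Λ₅ + 1ℚ)) ∙ X₆≡c ⊹ 1ℚ ∙ b-eq)

        X₅≡ : X₅ ≡ e * (e + 1ℚ)
        X₅≡ = combine (solve 6 (λ b c e Λ₅ X₅ X₆ → X₅ ⊖ e ⊗ (e ⊕ Κ (+ 1)) ⊜
          Κ (+ 1) ⊗ (X₆ ⊖ (Λ₅ ^ᴱ 2 ⊕ (Κ (+ 1) ⊖ c) ⊗ Λ₅ ⊕ b ⊖ X₅))
          ⊕ (⊝ Κ (+ 1)) ⊗ (X₆ ⊖ c) ⊕ (Λ₅ ⊕ e ⊕ (Κ (+ 1) ⊖ c)) ⊗ (Λ₅ ⊖ e)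
          ⊕ Κ (+ 1) ⊗ (b ⊖ c ⊗ (e ⊕ Κ (+ 1)))) refl b c e Λ₅ X₅ X₆)
          (1ℚ ∙ X₆-eq ⊹ (- 1ℚ) ∙ X₆≡c ⊹ (Λ₅ + e + (1ℚ - c)) ∙ Λ₅≡e ⊹ 1ℚ ∙ b-eq)

        X₄≢0 : X₄ ≢ 0ℚ
        X₄≢0 X₄≡0 = b≢0 (combine (solve 6 (λ b c e X Y Λ → b ⊖ Κ (+ 0) ⊜
          (⊝ Κ (+ 1)) ⊗ (Y ⊖ ((⊝ (e ⊕ (Κ (+ 1) ⊖ c))) ⊗ X ⊕ b))
          ⊕ Κ (+ 1) ⊗ (Y ⊖ Λ ⊗ X) ⊕ (Λ ⊕ e ⊕ (Κ (+ 1) ⊖ c)) ⊗ (X ⊖ Κ (+ 0))) refl b c e X₄ Y₄ Λ₄)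
          ((- 1ℚ) ∙ Y₄-eq ⊹ 1ℚ ∙ line₄ ⊹ (Λ₄ + e + (1ℚ - c)) ∙ X₄≡0))

        e≢0 : e ≢ 0ℚ
        e≢0 e≡0 = X₄≢0 (trans X₄≡ (trans (cong (_* (e + 1ℚ)) e≡0) (ℚ.*-zeroˡ (e + 1ℚ))))

        e+1≢0 : e + 1ℚ ≢ 0ℚ
        e+1≢0 e+1≡0 = X₄≢0 (trans X₄≡ (trans (cong (e *_) e+1≡0) (ℚ.*-zeroʳ e)))

        Λ₄e≡ : Λ₄ * e ≡ (e + 1ℚ) * (c - e)
        Λ₄e≡ = combine/ e+1≢0 (solve 6 (λ b c e X Y Λ →
          (e ⊕ Κ (+ 1)) ⊗ (Λ ⊗ e ⊖ (e ⊕ Κ (+ 1)) ⊗ (c ⊖ e)) ⊜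
          (⊝ Κ (+ 1)) ⊗ (Y ⊖ Λ ⊗ X)
          ⊕ Κ (+ 1) ⊗ (Y ⊖ ((⊝ (e ⊕ (Κ (+ 1) ⊖ c))) ⊗ X ⊕ b))
          ⊕ (⊝ (Λ ⊕ e ⊕ (Κ (+ 1) ⊖ c))) ⊗ (X ⊖ e ⊗ (e ⊕ Κ (+ 1)))
          ⊕ Κ (+ 1) ⊗ (b ⊖ c ⊗ (e ⊕ Κ (+ 1)))) refl b c e X₄ Y₄ Λ₄)
          ((- 1ℚ) ∙ line₄ ⊹ 1ℚ ∙ Y₄-eq ⊹ (- (Λ₄ + e + (1ℚ - c))) ∙ X₄≡ ⊹ 1ℚ ∙ b-eq)

        -- This is the condition for order 9: adding P to 4P must give the abscissa of 5P = -4P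
        -- found from above. After the factor e + 1 is removed, a cubic in (c , e) with a node at
        -- the origin remains, which is rational with parameter c / e.
        e³≡ : e ^ 3 ≡ c * (c - e)
        e³≡ = combine/ e+1≢0 (solve 6 (λ b c e X₄ X₅ Λ →
          (e ⊕ Κ (+ 1)) ⊗ (e ^ᴱ 3 ⊖ c ⊗ (c ⊖ e)) ⊜
          e ^ᴱ 2 ⊗ (X₅ ⊖ (Λ ^ᴱ 2 ⊕ (Κ (+ 1) ⊖ c) ⊗ Λ ⊕ b ⊖ X₄))
          ⊕ (⊝ e ^ᴱ 2) ⊗ (X₅ ⊖ e ⊗ (e ⊕ Κ (+ 1)))
          ⊕ (⊝ e ^ᴱ 2) ⊗ (X₄ ⊖ e ⊗ (e ⊕ Κ (+ 1)))
          ⊕ e ^ᴱ 2 ⊗ (b ⊖ c ⊗ (e ⊕ Κ (+ 1)))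
          ⊕ (Λ ⊗ e ⊕ (e ⊕ Κ (+ 1)) ⊗ (c ⊖ e) ⊕ (Κ (+ 1) ⊖ c) ⊗ e) ⊗ (Λ ⊗ e ⊖ (e ⊕ Κ (+ 1)) ⊗ (c ⊖ e)))
          refl b c e X₄ X₅ Λ₄)
          ((e ^ 2) ∙ X₅-eq ⊹ (- (e ^ 2)) ∙ X₅≡ ⊹ (- (e ^ 2)) ∙ X₄≡ ⊹ (e ^ 2) ∙ b-eq
            ⊹ (Λ₄ * e + (e + 1ℚ) * (c - e) + (1ℚ - c) * e) ∙ Λ₄e≡)

        -- f is Kubert's parameter.
        parametrisation : ∃[ f ] f ≢ 0ℚ × f - 1ℚ ≢ 0ℚ
          × c ≡ f ^ 2 * (f - 1ℚ) × b ≡ f ^ 2 * (f - 1ℚ) * (f ^ 2 - f + 1ℚ)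
        parametrisation = f , f≢0 , f-1≢0 , c≡ , b≡
          where
          e⁻¹ = proj₁ (inverse e≢0)
          ee⁻¹≡1 = proj₂ (inverse e≢0)
          f = c * e⁻¹
          fe≡c : f * e ≡ c
          fe≡c = combine (solve 3 (λ c e e⁻¹ → c ⊗ e⁻¹ ⊗ e ⊖ c ⊜ c ⊗ (e ⊗ e⁻¹ ⊖ Κ (+ 1))) refl c e e⁻¹)
            (c ∙ ee⁻¹≡1)
          e≡ : e ≡ f * (f - 1ℚ)
          e≡ = combine/ (*-≢0 e≢0 e≢0) (solve 3 (λ c e f → (e ⊗ e) ⊗ (e ⊖ f ⊗ (f ⊖ Κ (+ 1))) ⊜
            Κ (+ 1) ⊗ (e ^ᴱ 3 ⊖ c ⊗ (c ⊖ e)) ⊕ (⊝ (f ⊗ e ⊕ c ⊖ e)) ⊗ (f ⊗ e ⊖ c)) refl c e f)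
            (1ℚ ∙ e³≡ ⊹ (- (f * e + c - e)) ∙ fe≡c)
          f≢0 : f ≢ 0ℚ
          f≢0 f≡0 = c≢0 (trans (sym fe≡c) (trans (cong (_* e) f≡0) (ℚ.*-zeroˡ e)))
          f-1≢0 : f - 1ℚ ≢ 0ℚ
          f-1≢0 f-1≡0 = e≢0 (trans e≡ (trans (cong (f *_) f-1≡0) (ℚ.*-zeroʳ f)))
          c≡ : c ≡ f ^ 2 * (f - 1ℚ)
          c≡ = combine (solve 3 (λ c e f → c ⊖ f ^ᴱ 2 ⊗ (f ⊖ Κ (+ 1)) ⊜
            (⊝ Κ (+ 1)) ⊗ (f ⊗ e ⊖ c) ⊕ f ⊗ (e ⊖ f ⊗ (f ⊖ Κ (+ 1)))) refl c e f)
            ((- 1ℚ) ∙ fe≡c ⊹ f ∙ e≡)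
          b≡ : b ≡ f ^ 2 * (f - 1ℚ) * (f ^ 2 - f + 1ℚ)
          b≡ = combine (solve 4 (λ b c e f → b ⊖ f ^ᴱ 2 ⊗ (f ⊖ Κ (+ 1)) ⊗ (f ^ᴱ 2 ⊖ f ⊕ Κ (+ 1)) ⊜
            Κ (+ 1) ⊗ (b ⊖ c ⊗ (e ⊕ Κ (+ 1)))
            ⊕ c ⊗ (e ⊖ f ⊗ (f ⊖ Κ (+ 1)))
            ⊕ (f ^ᴱ 2 ⊖ f ⊕ Κ (+ 1)) ⊗ (c ⊖ f ^ᴱ 2 ⊗ (f ⊖ Κ (+ 1)))) refl b c e f)
            (1ℚ ∙ b-eq ⊹ c ∙ e≡ ⊹ (f ^ 2 - f + 1ℚ) ∙ c≡)

  -- The curve moved so that the point (r , t) becomes (0 , 0) and its tangent of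
  -- slope s becomes horizontal, and then scaled by v so that a₂ = a₃.
  module Normalise (W : Weierstrass ℚ) (r t s : ℚ) where
    open Weierstrass W
    open WeierstrassOver ℚ-ring W
    open Weierstrass (translate r s t W) public
      renaming (a₁ to A₁; a₂ to A₂; a₃ to A₃; a₄ to A₄; a₆ to A₆)

    module Scaled (v : ℚ) where
      b c : ℚ
      b = - (A₂ * v ^ 2)
      c = 1ℚ - A₁ * v

      X : ℚ → ℚ
      X x = (x - r) * v ^ 2

      Y : ℚ → ℚ → ℚ
      Y x y = (y - s * (x - r) - t) * v ^ 3

    module _ (on-curve : f r t ≡ 0ℚ) (smooth : fʸ r t ≢ 0ℚ) (slope-eq : s * fʸ r t ≡ - fˣ r t) where

      A₃≢0 : A₃ ≢ 0ℚ
      A₃≢0 A₃≡0 = smooth (trans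
        (solve 4 (λ a₁ a₃ r t → 2 ·ᴱ t ⊕ a₁ ⊗ r ⊕ a₃ ⊜ a₃ ⊕ r ⊗ a₁ ⊕ 2 ·ᴱ t) refl a₁ a₃ r t) A₃≡0)

      A₄≡0 : A₄ ≡ 0ℚ
      A₄≡0 = combine (solve 7 (λ a₁ a₂ a₃ a₄ r s t →
        (a₄ ⊖ s ⊗ a₃ ⊕ 2 ·ᴱ (r ⊗ a₂) ⊖ (t ⊕ r ⊗ s) ⊗ a₁ ⊕ 3 ·ᴱ r ^ᴱ 2 ⊖ 2 ·ᴱ (s ⊗ t)) ⊖ Κ (+ 0) ⊜
        (⊝ Κ (+ 1)) ⊗ (s ⊗ (2 ·ᴱ t ⊕ a₁ ⊗ r ⊕ a₃) ⊖ (⊝ (a₁ ⊗ t ⊖ (3 ·ᴱ r ^ᴱ 2 ⊕ 2 ·ᴱ (a₂ ⊗ r) ⊕ a₄)))))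
        refl a₁ a₂ a₃ a₄ r s t) ((- 1ℚ) ∙ slope-eq)

      A₆≡0 : A₆ ≡ 0ℚ
      A₆≡0 = combine (solve 7 (λ a₁ a₂ a₃ a₄ a₆ r t →
        (a₆ ⊕ r ⊗ a₄ ⊕ r ^ᴱ 2 ⊗ a₂ ⊕ r ^ᴱ 3 ⊖ t ⊗ a₃ ⊖ t ^ᴱ 2 ⊖ r ⊗ t ⊗ a₁) ⊖ Κ (+ 0) ⊜
        (⊝ Κ (+ 1)) ⊗ ((t ^ᴱ 2 ⊕ a₁ ⊗ r ⊗ t ⊕ a₃ ⊗ t) ⊖ (r ^ᴱ 3 ⊕ a₂ ⊗ r ^ᴱ 2 ⊕ a₄ ⊗ r ⊕ a₆) ⊖ Κ (+ 0)))
        refl a₁ a₂ a₃ a₄ a₆ r t) ((- 1ℚ) ∙ on-curve)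

      -- Otherwise (r , t) would have order 3.
      A₂≢0 : ∀ {x₂ y₂ e₂ x₃ y₃ e₃} →
        IsSum (aff r t on-curve) (aff r t on-curve) (aff x₂ y₂ e₂) →
        IsSum (aff x₂ y₂ e₂) (aff r t on-curve) (aff x₃ y₃ e₃) → A₂ ≢ 0ℚ
      A₂≢0 (_ , chord r≢r _ , _) _ _ = ⊥-elim (r≢r refl)
      A₂≢0 {x₂} {y₂} (λ′ , tangent _ _ _ λ-eq , x₂-eq , y₂-eq) (_ , slope₂ , _) A₂≡0 = case slope₂
        where
        λ≡s : λ′ ≡ s
        λ≡s = combine/ smooth (solve 4 (λ λ′ s f g → f ⊗ (λ′ ⊖ s) ⊜
          Κ (+ 1) ⊗ (λ′ ⊗ f ⊖ g) ⊕ (⊝ Κ (+ 1)) ⊗ (s ⊗ f ⊖ g)) refl λ′ s (fʸ r t) (- fˣ r t))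
          (1ℚ ∙ λ-eq ⊹ (- 1ℚ) ∙ slope-eq)
        x₂≡r : x₂ ≡ r
        x₂≡r = combine (solve 6 (λ a₁ a₂ λ′ r s x₂ → x₂ ⊖ r ⊜
          Κ (+ 1) ⊗ (x₂ ⊖ (λ′ ^ᴱ 2 ⊕ a₁ ⊗ λ′ ⊖ a₂ ⊖ r ⊖ r))
          ⊕ (λ′ ⊕ s ⊕ a₁) ⊗ (λ′ ⊖ s)
          ⊕ (⊝ Κ (+ 1)) ⊗ ((a₂ ⊖ s ⊗ a₁ ⊕ 3 ·ᴱ r ⊖ s ^ᴱ 2) ⊖ Κ (+ 0))) refl a₁ a₂ λ′ r s x₂)
          (1ℚ ∙ x₂-eq ⊹ (λ′ + s + a₁) ∙ λ≡s ⊹ (- 1ℚ) ∙ A₂≡0)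
        case : IsSlope x₂ y₂ r t _ → _
        case (chord x₂≢r _) = x₂≢r x₂≡r
        case (tangent _ y₂≡t _ _) = smooth (combine (solve 7 (λ a₁ a₃ λ′ r t x₂ y₂ →
          (2 ·ᴱ t ⊕ a₁ ⊗ r ⊕ a₃) ⊖ Κ (+ 0) ⊜
          Κ (+ 1) ⊗ (y₂ ⊖ ((⊝ (λ′ ⊕ a₁)) ⊗ x₂ ⊖ (t ⊖ λ′ ⊗ r) ⊖ a₃))
          ⊕ (⊝ Κ (+ 1)) ⊗ (y₂ ⊖ t) ⊕ (⊝ (λ′ ⊕ a₁)) ⊗ (x₂ ⊖ r)) refl a₁ a₃ λ′ r t x₂ y₂)
          (1ℚ ∙ y₂-eq ⊹ (- 1ℚ) ∙ y₂≡t ⊹ (- (λ′ + a₁)) ∙ x₂≡r))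

      module _ (v : ℚ) (v≢0 : v ≢ 0ℚ) (a₂=a₃ : A₂ * v ^ 2 ≡ A₃ * v ^ 3) where
        open Scaled v

        X≡0⇒x≡r : ∀ {x} → X x ≡ 0ℚ → x ≡ r
        X≡0⇒x≡r {x} X≡0 = combine/ (*-≢0 v≢0 v≢0)
          (solve 3 (λ x r v → (v ⊗ v) ⊗ (x ⊖ r) ⊜ Κ (+ 1) ⊗ ((x ⊖ r) ⊗ v ^ᴱ 2 ⊖ Κ (+ 0))) refl x r v)
          (1ℚ ∙ X≡0)

        curve : ∀ {x y} → f x y ≡ 0ℚ →
          Y x y ^ 2 + (1ℚ - c) * X x * Y x y - b * Y x y ≡ X x ^ 3 - b * X x ^ 2
        curve {x} {y} e = combine (solve 11 (λ a₁ a₂ a₃ a₄ a₆ r s t v x y →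
          let X = (x ⊖ r) ⊗ v ^ᴱ 2
              Y = (y ⊖ s ⊗ (x ⊖ r) ⊖ t) ⊗ v ^ᴱ 3
              weierstrass A₁ A₂ A₃ A₄ A₆ = translateᴱ r s t (weierstrass a₁ a₂ a₃ a₄ a₆)
              b = ⊝ (A₂ ⊗ v ^ᴱ 2)
              c = Κ (+ 1) ⊖ A₁ ⊗ v
          in (Y ^ᴱ 2 ⊕ (Κ (+ 1) ⊖ c) ⊗ X ⊗ Y ⊖ b ⊗ Y) ⊖ (X ^ᴱ 3 ⊖ b ⊗ X ^ᴱ 2) ⊜
             v ^ᴱ 6 ⊗ ((y ^ᴱ 2 ⊕ a₁ ⊗ x ⊗ y ⊕ a₃ ⊗ y) ⊖ (x ^ᴱ 3 ⊕ a₂ ⊗ x ^ᴱ 2 ⊕ a₄ ⊗ x ⊕ a₆) ⊖ Κ (+ 0))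
             ⊕ (v ^ᴱ 4 ⊗ X) ⊗ (A₄ ⊖ Κ (+ 0)) ⊕ v ^ᴱ 6 ⊗ (A₆ ⊖ Κ (+ 0))
             ⊕ Y ⊗ (A₂ ⊗ v ^ᴱ 2 ⊖ A₃ ⊗ v ^ᴱ 3))
          refl a₁ a₂ a₃ a₄ a₆ r s t v x y)
          ((v ^ 6) ∙ e ⊹ (v ^ 4 * X x) ∙ A₄≡0 ⊹ (v ^ 6) ∙ A₆≡0 ⊹ Y x y ∙ a₂=a₃)

        -- Chords and tangents alike satisfy λ′ (r - x) = t - y; for a tangent both sides vanish.
        -- The two kinds of slope have to be told apart only for the field `horizontal`.
        normalise-step : ∀ {x y e x′ y′ e′} →
          IsSum (aff x y e) (aff r t on-curve) (aff x′ y′ e′) →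
          Step b c (X x) (Y x y) (X x′) (Y x′ y′)
        normalise-step {x} {y} {_} {x′} {y′} (λ′ , is-slope , x′-eq , y′-eq) = step Λ
          (combine (solve 7 (λ λ′ r s t v x y →
              (y ⊖ s ⊗ (x ⊖ r) ⊖ t) ⊗ v ^ᴱ 3 ⊖ (λ′ ⊖ s) ⊗ v ⊗ ((x ⊖ r) ⊗ v ^ᴱ 2) ⊜
              v ^ᴱ 3 ⊗ (λ′ ⊗ (r ⊖ x) ⊖ (t ⊖ y))) refl λ′ r s t v x y)
            ((v ^ 3) ∙ line is-slope))
          (combine (solve 8 (λ a₁ a₂ λ′ r s v x x′ →
              let X = (x ⊖ r) ⊗ v ^ᴱ 2
                  X′ = (x′ ⊖ r) ⊗ v ^ᴱ 2
                  Λ = (λ′ ⊖ s) ⊗ v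
                  b = ⊝ ((a₂ ⊖ s ⊗ a₁ ⊕ 3 ·ᴱ r ⊖ s ^ᴱ 2) ⊗ v ^ᴱ 2)
                  c = Κ (+ 1) ⊖ (a₁ ⊕ 2 ·ᴱ s) ⊗ v
              in X′ ⊖ (Λ ^ᴱ 2 ⊕ (Κ (+ 1) ⊖ c) ⊗ Λ ⊕ b ⊖ X) ⊜
                 v ^ᴱ 2 ⊗ (x′ ⊖ (λ′ ^ᴱ 2 ⊕ a₁ ⊗ λ′ ⊖ a₂ ⊖ x ⊖ r))) refl a₁ a₂ λ′ r s v x x′)
            ((v ^ 2) ∙ x′-eq))
          (combine (solve 12 (λ a₁ a₂ a₃ λ′ r s t v x y x′ y′ →
              let X′ = (x′ ⊖ r) ⊗ v ^ᴱ 2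
                  Y′ = (y′ ⊖ s ⊗ (x′ ⊖ r) ⊖ t) ⊗ v ^ᴱ 3
                  Λ = (λ′ ⊖ s) ⊗ v
                  A₂ = a₂ ⊖ s ⊗ a₁ ⊕ 3 ·ᴱ r ⊖ s ^ᴱ 2
                  A₃ = a₃ ⊕ r ⊗ a₁ ⊕ 2 ·ᴱ t
                  b = ⊝ (A₂ ⊗ v ^ᴱ 2)
                  c = Κ (+ 1) ⊖ (a₁ ⊕ 2 ·ᴱ s) ⊗ v
              in Y′ ⊖ ((⊝ (Λ ⊕ (Κ (+ 1) ⊖ c))) ⊗ X′ ⊕ b) ⊜
                 v ^ᴱ 3 ⊗ (y′ ⊖ ((⊝ (λ′ ⊕ a₁)) ⊗ x′ ⊖ (y ⊖ λ′ ⊗ x) ⊖ a₃))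
                 ⊕ (⊝ v ^ᴱ 3) ⊗ (λ′ ⊗ (r ⊖ x) ⊖ (t ⊖ y))
                 ⊕ Κ (+ 1) ⊗ (A₂ ⊗ v ^ᴱ 2 ⊖ A₃ ⊗ v ^ᴱ 3)) refl a₁ a₂ a₃ λ′ r s t v x y x′ y′)
            ((v ^ 3) ∙ y′-eq ⊹ (- (v ^ 3)) ∙ line is-slope ⊹ 1ℚ ∙ a₂=a₃))
          (slope-0 is-slope)
          where
          Λ = (λ′ - s) * v
          line : IsSlope x y r t λ′ → λ′ * (r - x) ≡ t - y
          line (chord _ eq) = eq
          line (tangent x≡r y≡t _ _) = combine (solve 5 (λ λ′ r t x y → λ′ ⊗ (r ⊖ x) ⊖ (t ⊖ y) ⊜
            (⊝ λ′) ⊗ (x ⊖ r) ⊕ Κ (+ 1) ⊗ (y ⊖ t)) refl λ′ r t x y) ((- λ′) ∙ x≡r ⊹ 1ℚ ∙ y≡t)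
          slope-0 : IsSlope x y r t λ′ → X x ≡ 0ℚ → Λ ≡ 0ℚ
          slope-0 (chord x≢r _) X≡0 = ⊥-elim (x≢r (X≡0⇒x≡r X≡0))
          slope-0 (tangent refl refl _ λ-eq) _ = combine/ smooth (solve 5 (λ λ′ s v f g →
            f ⊗ ((λ′ ⊖ s) ⊗ v ⊖ Κ (+ 0)) ⊜ v ⊗ (λ′ ⊗ f ⊖ g) ⊕ (⊝ v) ⊗ (s ⊗ f ⊖ g))
            refl λ′ s v (fʸ r t) (- fˣ r t))
            (v ∙ λ-eq ⊹ (- v) ∙ slope-eq)

  -- From a point of order 9 to Kubert's family.

  open WeierstrassOver using (aff; 𝒪; chord; tangent)

  ≅-scale : ∀ W W′ {n} → n ≢ 0ℚ → W ≅ W′ → W ≅ scale n W′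
  ≅-scale (weierstrass _ _ _ _ _) (weierstrass a₁ a₂ a₃ a₄ a₆) {n} n≢0 (u , r , s , t , u≢0 , e₁ , e₂ , e₃ , e₄ , e₆) =
    w , r , s , t , w≢0 ,
    trans (combine (solve 4 (λ n w u a → w ⊗ (n ⊗ a) ⊖ u ⊗ a ⊜ a ⊗ (w ⊗ n ⊖ u)) refl n w u a₁) (a₁ ∙ wn≡u)) e₁ ,
    trans (power 2 (solve 3 (λ n w a → w ^ᴱ 2 ⊗ (n ^ᴱ 2 ⊗ a) ⊜ (w ⊗ n) ^ᴱ 2 ⊗ a) refl n w a₂)) e₂ ,
    trans (power 3 (solve 3 (λ n w a → w ^ᴱ 3 ⊗ (n ^ᴱ 3 ⊗ a) ⊜ (w ⊗ n) ^ᴱ 3 ⊗ a) refl n w a₃)) e₃ ,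
    trans (power 4 (solve 3 (λ n w a → w ^ᴱ 4 ⊗ (n ^ᴱ 4 ⊗ a) ⊜ (w ⊗ n) ^ᴱ 4 ⊗ a) refl n w a₄)) e₄ ,
    trans (power 6 (solve 3 (λ n w a → w ^ᴱ 6 ⊗ (n ^ᴱ 6 ⊗ a) ⊜ (w ⊗ n) ^ᴱ 6 ⊗ a) refl n w a₆)) e₆
    where
    n⁻¹ = proj₁ (inverse n≢0)
    w = u * n⁻¹
    wn≡u : w * n ≡ u
    wn≡u = combine (solve 3 (λ u n n⁻¹ → u ⊗ n⁻¹ ⊗ n ⊖ u ⊜ u ⊗ (n ⊗ n⁻¹ ⊖ Κ (+ 1))) refl u n n⁻¹)
      (u ∙ proj₂ (inverse n≢0))
    w≢0 : w ≢ 0ℚ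
    w≢0 w≡0 = u≢0 (trans (sym wn≡u) (trans (cong (_* n) w≡0) (ℚ.*-zeroˡ n)))
    power : ∀ k {a x} → x ≡ (w * n) ^ k * a → x ≡ u ^ k * a
    power k {a} eq = trans eq (cong (λ z → z ^ k * a) wn≡u)

  kubert : ℚ → Weierstrass ℚ
  kubert f = tateForm (f ^ 2 * (f - 1ℚ) * (f ^ 2 - f + 1ℚ)) (f ^ 2 * (f - 1ℚ))

  -- A proof of order 9 carries the chain P, 2P, ..., 8P. If one of these is 𝒪, the minimality of 9
  -- or the shape of the sums is contradicted, so the content is in the last clause, where all are
  -- affine.
  order-9⇒kubert : ∀ {E} → HasRationalPointOfOrder E 9 →
    ∃[ f ] f ≢ 0ℚ × f - 1ℚ ≢ 0ℚ × equation E ≅ kubert f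
  order-9⇒kubert (_ , (𝒪 , m , _) , minimal) = ⊥-elim (minimal 8 z<s (from-yes (8 ℕ.<? 9)) m)
  order-9⇒kubert (_ , (_ , (𝒪 , m , _) , _) , minimal) = ⊥-elim (minimal 7 z<s (from-yes (7 ℕ.<? 9)) m)
  order-9⇒kubert (_ , (_ , (_ , (𝒪 , m , _) , _) , _) , minimal) = ⊥-elim (minimal 6 z<s (from-yes (6 ℕ.<? 9)) m)
  order-9⇒kubert (_ , (_ , (_ , (_ , (𝒪 , m , _) , _) , _) , _) , minimal) =
    ⊥-elim (minimal 5 z<s (from-yes (5 ℕ.<? 9)) m)
  order-9⇒kubert (_ , (_ , (_ , (_ , (_ , (𝒪 , m , _) , _) , _) , _) , _) , minimal) =
    ⊥-elim (minimal 4 z<s (from-yes (4 ℕ.<? 9)) m)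
  order-9⇒kubert (_ , (_ , (_ , (_ , (_ , (_ , (𝒪 , m , _) , _) , _) , _) , _) , _) , minimal) =
    ⊥-elim (minimal 3 z<s (from-yes (3 ℕ.<? 9)) m)
  order-9⇒kubert (_ , (_ , (_ , (_ , (_ , (_ , (_ , (𝒪 , m , _) , _) , _) , _) , _) , _) , _) , minimal) =
    ⊥-elim (minimal 2 z<s (from-yes (2 ℕ.<? 9)) m)
  order-9⇒kubert (𝒪 , _ , minimal) = ⊥-elim (minimal 1 z<s (from-yes (1 ℕ.<? 9)) (𝒪 , tt , tt))
  order-9⇒kubert (aff _ _ _ , (_ , (_ , (_ , (_ , (_ , (_ , (_ , (𝒪 , (𝒪 , _ , ()) , _) , _) , _) , _) , _) , _) , _) , _) , _)
  order-9⇒kubert (aff _ _ _ , (_ , (_ , (_ , (_ , (_ , (_ , (_ , (_ , (aff _ _ _ , () , _) , _) , _) , _) , _) , _) , _) , _) , _) , _)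
  order-9⇒kubert {E} (aff r t e ,
    (aff x₈ y₈ e₈ , (aff x₇ y₇ e₇ , (aff x₆ y₆ e₆ , (aff x₅ y₅ e₅ , (aff x₄ y₄ e₄ , (aff x₃ y₃ e₃ ,
      (aff x₂ y₂ e₂ , (aff x₁ y₁ e₁ , (𝒪 , _ , r≡x₁ , t≡y₁) , 1+1) , 2+1) , 3+1) , 4+1) , 5+1) , 6+1) , 7+1) ,
      (x₈≡r , _)) , _) = kubert-form (slope-of 1+1)
    where
    W = equation E
    open WeierstrassOver ℚ-ring W using (f; fˣ; fʸ; IsSum)
    slope-of : IsSum (aff x₁ y₁ e₁) (aff r t e) (aff x₂ y₂ e₂) →
      ∃[ s ] fʸ r t ≢ 0ℚ × s * fʸ r t ≡ - fˣ r t
    slope-of (_ , chord x₁≢r _ , _) = ⊥-elim (x₁≢r (sym r≡x₁))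
    slope-of (s , tangent refl refl smooth eq , _) = s , smooth , eq

    kubert-form : ∃[ s ] fʸ r t ≢ 0ℚ × s * fʸ r t ≡ - fˣ r t →
      ∃[ f ] f ≢ 0ℚ × f - 1ℚ ≢ 0ℚ × W ≅ kubert f
    kubert-form (s , smooth , eq) =
      let f , f≢0 , f-1≢0 , c≡ , b≡ =
            parametrisation b≢0 3P+P≡4P 
              (normalised {x₄} {y₄} {e₄} {x₅} {y₅} {e₅} 4+1) (normalised {x₅} {y₅} {e₅} {x₆} {y₆} {e₆} 5+1)
              (normalised {x₆} {y₆} {e₆} {x₇} {y₇} {e₇} 6+1) (normalised {x₇} {y₇} {e₇} {x₈} {y₈} {e₈} 7+1)
              (N.curve e smooth eq v v≢0 a₂=a₃ {x₇} {y₇} e₇) (X≡0 x₈≡r)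
      in f , f≢0 , f-1≢0 , subst₂ (λ b c → W ≅ tateForm b c) b≡ c≡ W≅tateForm
      where
      module N = Normalise W r t s
      open N using (A₁; A₂; A₃; A₄; A₆)
      A₃≢0 : A₃ ≢ 0ℚ
      A₃≢0 = N.A₃≢0 e smooth eq
      A₂≢0 : A₂ ≢ 0ℚ
      A₂≢0 = N.A₂≢0 e smooth eq {x₂} {y₂} {e₂} {x₃} {y₃} {e₃} (replace {e′ = e₁} r≡x₁ t≡y₁ 1+1) 2+1
        where
        replace : ∀ {x y e′} → r ≡ x → t ≡ y →
          IsSum (aff x y e′) (aff r t e) (aff x₂ y₂ e₂) → IsSum (aff r t e) (aff r t e) (aff x₂ y₂ e₂)
        replace refl refl sum = sum
      A₂⁻¹ = proj₁ (inverse A₂≢0)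
      A₃⁻¹ = proj₁ (inverse A₃≢0)
      -- Scaling turns A₂ and A₃ into A₂ v² and A₃ v³, which agree for this v.
      v = A₂ * A₃⁻¹
      u = A₃ * A₂⁻¹
      uv≡1 : u * v ≡ 1ℚ
      uv≡1 = combine (solve 4 (λ A₂ A₂⁻¹ A₃ A₃⁻¹ → A₃ ⊗ A₂⁻¹ ⊗ (A₂ ⊗ A₃⁻¹) ⊖ Κ (+ 1) ⊜
        (A₃ ⊗ A₃⁻¹) ⊗ (A₂ ⊗ A₂⁻¹ ⊖ Κ (+ 1)) ⊕ Κ (+ 1) ⊗ (A₃ ⊗ A₃⁻¹ ⊖ Κ (+ 1))) refl A₂ A₂⁻¹ A₃ A₃⁻¹)
        ((A₃ * A₃⁻¹) ∙ proj₂ (inverse A₂≢0) ⊹ 1ℚ ∙ proj₂ (inverse A₃≢0))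
      u≢0 : u ≢ 0ℚ
      u≢0 u≡0 = 1≢0 (trans (sym uv≡1) (trans (cong (_* v) u≡0) (ℚ.*-zeroˡ v)))
        where
        1≢0 : 1ℚ ≢ 0ℚ
        1≢0 ()
      v≢0 : v ≢ 0ℚ
      v≢0 v≡0 = A₂≢0 (combine (solve 3 (λ A₂ A₃ A₃⁻¹ → A₂ ⊖ Κ (+ 0) ⊜
        (⊝ A₂) ⊗ (A₃ ⊗ A₃⁻¹ ⊖ Κ (+ 1)) ⊕ A₃ ⊗ (A₂ ⊗ A₃⁻¹ ⊖ Κ (+ 0))) refl A₂ A₃ A₃⁻¹)
        ((- A₂) ∙ proj₂ (inverse A₃≢0) ⊹ A₃ ∙ v≡0))
      a₂=a₃ : A₂ * v ^ 2 ≡ A₃ * v ^ 3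
      a₂=a₃ = combine (solve 3 (λ A₂ A₃ A₃⁻¹ → let v = A₂ ⊗ A₃⁻¹ in
        A₂ ⊗ v ^ᴱ 2 ⊖ A₃ ⊗ v ^ᴱ 3 ⊜ (⊝ A₂ ⊗ v ^ᴱ 2) ⊗ (A₃ ⊗ A₃⁻¹ ⊖ Κ (+ 1))) refl A₂ A₃ A₃⁻¹)
        ((- A₂ * v ^ 2) ∙ proj₂ (inverse A₃≢0))
      open N.Scaled v using (b; c; X; Y)
      b≢0 : b ≢ 0ℚ
      b≢0 b≡0 = A₂≢0 (combine (solve 3 (λ A₂ u v → A₂ ⊖ Κ (+ 0) ⊜
        (⊝ u ^ᴱ 2) ⊗ (⊝ (A₂ ⊗ v ^ᴱ 2) ⊖ Κ (+ 0)) ⊕ (⊝ (A₂ ⊗ (u ⊗ v ⊕ Κ (+ 1)))) ⊗ (u ⊗ v ⊖ Κ (+ 1))) refl A₂ u v)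
        ((- u ^ 2) ∙ b≡0 ⊹ (- (A₂ * (u * v + 1ℚ))) ∙ uv≡1))

      normalised : ∀ {x y e′ x′ y′ e″} → IsSum (aff x y e′) (aff r t e) (aff x′ y′ e″) →
        Step b c (X x) (Y x y) (X x′) (Y x′ y′)
      normalised {x} {y} {e′} {x′} {y′} {e″} =
        N.normalise-step e smooth eq v v≢0 a₂=a₃ {x} {y} {e′} {x′} {y′} {e″}

      X≡0 : ∀ {x} → x ≡ r → X x ≡ 0ℚ
      X≡0 {x} x≡r = combine (solve 3 (λ x r v → (x ⊖ r) ⊗ v ^ᴱ 2 ⊖ Κ (+ 0) ⊜ v ^ᴱ 2 ⊗ (x ⊖ r)) refl x r v)
        ((v ^ 2) ∙ x≡r)

      2P+P≡3P : Step b c b (b * c) (X x₃) (Y x₃ y₃)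
      2P+P≡3P = let X₂≡ , Y₂≡ = step-0 b≢0 (X≡0 (sym r≡x₁)) (normalised {x₁} {y₁} {e₁} {x₂} {y₂} {e₂} 1+1) in
        subst₂ (λ X₂ Y₂ → Step b c X₂ Y₂ (X x₃) (Y x₃ y₃)) X₂≡ Y₂≡ (normalised {x₂} {y₂} {e₂} {x₃} {y₃} {e₃} 2+1)
      3P+P≡4P : Step b c c (b - c) (X x₄) (Y x₄ y₄)
      3P+P≡4P = let X₃≡ , Y₃≡ = step-2P b≢0 2P+P≡3P in
        subst₂ (λ X₃ Y₃ → Step b c X₃ Y₃ (X x₄) (Y x₄ y₄)) X₃≡ Y₃≡ (normalised {x₃} {y₃} {e₃} {x₄} {y₄} {e₄} 3+1)

      W≅tateForm : W ≅ tateForm b c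
      W≅tateForm = u , r , s , t , u≢0
        , combine (solve 3 (λ A₁ u v → u ⊗ (Κ (+ 1) ⊖ (Κ (+ 1) ⊖ A₁ ⊗ v)) ⊖ A₁ ⊜
            A₁ ⊗ (u ⊗ v ⊖ Κ (+ 1))) refl A₁ u v) (A₁ ∙ uv≡1)
        , combine (solve 3 (λ A₂ u v → u ^ᴱ 2 ⊗ (⊝ (⊝ (A₂ ⊗ v ^ᴱ 2))) ⊖ A₂ ⊜
            (A₂ ⊗ (u ⊗ v ⊕ Κ (+ 1))) ⊗ (u ⊗ v ⊖ Κ (+ 1))) refl A₂ u v) ((A₂ * (u * v + 1ℚ)) ∙ uv≡1)
        , combine (solve 4 (λ A₂ A₃ u v → u ^ᴱ 3 ⊗ (⊝ (⊝ (A₂ ⊗ v ^ᴱ 2))) ⊖ A₃ ⊜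
            u ^ᴱ 3 ⊗ (A₂ ⊗ v ^ᴱ 2 ⊖ A₃ ⊗ v ^ᴱ 3)
            ⊕ (A₃ ⊗ ((u ⊗ v) ^ᴱ 2 ⊕ u ⊗ v ⊕ Κ (+ 1))) ⊗ (u ⊗ v ⊖ Κ (+ 1))) refl A₂ A₃ u v)
            ((u ^ 3) ∙ a₂=a₃ ⊹ (A₃ * ((u * v) ^ 2 + u * v + 1ℚ)) ∙ uv≡1)
        , trans (ℚ.*-zeroʳ (u ^ 4)) (sym (N.A₄≡0 e smooth eq))
        , trans (ℚ.*-zeroʳ (u ^ 6)) (sym (N.A₆≡0 e smooth eq))

  -- Integral models with coprime parameters.

  ↥-↧ : ∀ q → ℤ→ℚ (ℚ.↥ q) ≡ ℤ→ℚ (ℚ.↧ q) * q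
  ↥-↧ q@(ℚ.mkℚ n d-1 _) = ℚ.toℚᵘ-injective (begin
    ℚ.toℚᵘ (ℤ→ℚ n)                              ≈⟨ ℚ.toℚᵘ-fromℚᵘ (ℚᵘ.mkℚᵘ n 0) ⟩
    ℚᵘ.mkℚᵘ n 0                                  ≈⟨ ℚᵘ.*≡* (ℤ-Solver.solve 2 (λ n d →
        n ⊗ (Κ (+ 1) ⊗ d) ⊜ d ⊗ n ⊗ Κ (+ 1)) refl n (+ suc d-1)) ⟩
    ℚᵘ.mkℚᵘ (+ suc d-1) 0 ℚᵘ.* ℚᵘ.mkℚᵘ n d-1     ≈⟨ ℚᵘ.*-congʳ {ℚ.toℚᵘ q} (ℚ.toℚᵘ-fromℚᵘ (ℚᵘ.mkℚᵘ (+ suc d-1) 0)) ⟨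
    ℚ.toℚᵘ (ℤ→ℚ (+ suc d-1)) ℚᵘ.* ℚ.toℚᵘ q       ≈⟨ ℚ.toℚᵘ-homo-* (ℤ→ℚ (+ suc d-1)) q ⟨
    ℚ.toℚᵘ (ℤ→ℚ (+ suc d-1) * q)                 ∎)
    where open ℚᵘ.≃-Reasoning

  Fᴱ gᴱ : ∀ {k} → Expr ℤ k → Expr ℤ k → Expr ℤ k
  Fᴱ m n = m ⊗ m ⊖ m ⊗ n ⊕ n ⊗ n
  gᴱ m n = m ⊗ m ⊗ (m ⊖ n) ⊗ Fᴱ m n

  -- F is the norm form of the Eisenstein integers, and g is n⁵ b for f = m / n. Since b enters a₂
  -- and a₃ with weights 2 and 3, scaling by n³ clears all denominators and leaves the factors n and
  -- n⁴.
  F g : ℤ → ℤ → ℤ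
  F m n = m ℤ.* m ℤ.- m ℤ.* n ℤ.+ n ℤ.* n
  g m n = m ℤ.* m ℤ.* (m ℤ.- n) ℤ.* F m n

  -- kubert (m / n) scaled by n³
  integralModel : ℤ → ℤ → Weierstrass ℤ
  integralModel m n = weierstrass
    (n ℤ.* n ℤ.* n ℤ.- m ℤ.* m ℤ.* (m ℤ.- n))
    (ℤ.- (n ℤ.* g m n))
    (ℤ.- (n ℤ.* n ℤ.* n ℤ.* n ℤ.* g m n))
    (+ 0) (+ 0)

  mapW-integralModel : ∀ {f} m n → ℤ→ℚ m ≡ ℤ→ℚ n * f →
    mapW ℤ→ℚ (integralModel m n) ≡ scale (ℤ→ℚ n ^ 3) (kubert f)
  mapW-integralModel {f} m n m≡nf = weierstrass-cong
    (coefficient (n′ ⊗ n′ ⊗ n′ ⊖ m′ ⊗ m′ ⊗ (m′ ⊖ n′)) (solve 2 (λ n f → let m = n ⊗ f in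
      n ⊗ n ⊗ n ⊖ m ⊗ m ⊗ (m ⊖ n) ⊜ n ^ᴱ 3 ⊗ (Κ (+ 1) ⊖ f ^ᴱ 2 ⊗ (f ⊖ Κ (+ 1)))) refl (ℤ→ℚ n) f))
    (coefficient (⊝ (n′ ⊗ gᴱ m′ n′)) (solve 2 (λ n f → let m = n ⊗ f in
      ⊝ (n ⊗ gᴱ m n) ⊜ (n ^ᴱ 3) ^ᴱ 2 ⊗ (⊝ (f ^ᴱ 2 ⊗ (f ⊖ Κ (+ 1)) ⊗ (f ^ᴱ 2 ⊖ f ⊕ Κ (+ 1))))) refl (ℤ→ℚ n) f))
    (coefficient (⊝ (n′ ⊗ n′ ⊗ n′ ⊗ n′ ⊗ gᴱ m′ n′)) (solve 2 (λ n f → let m = n ⊗ f in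
      ⊝ (n ⊗ n ⊗ n ⊗ n ⊗ gᴱ m n) ⊜
      (n ^ᴱ 3) ^ᴱ 3 ⊗ (⊝ (f ^ᴱ 2 ⊗ (f ⊖ Κ (+ 1)) ⊗ (f ^ᴱ 2 ⊖ f ⊕ Κ (+ 1))))) refl (ℤ→ℚ n) f))
    (sym (ℚ.*-zeroʳ ((ℤ→ℚ n ^ 3) ^ 4)))
    (sym (ℚ.*-zeroʳ ((ℤ→ℚ n ^ 3) ^ 6)))
    where
    m′ n′ : Expr ℤ 2
    m′ = Ι 0F
    n′ = Ι 1F
    coefficient : ∀ e {x} → ℚ-Solver.⟦ e ⟧ (ℤ→ℚ n * f ∷ ℤ→ℚ n ∷ []) ≡ x →
      ℤ→ℚ (ℤ-Solver.⟦ e ⟧ (m ∷ n ∷ [])) ≡ x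
    coefficient e eq = trans (ℤ→ℚ-⟦⟧ e (m ∷ n ∷ []))
      (trans (cong (λ z → ℚ-Solver.⟦ e ⟧ (z ∷ ℤ→ℚ n ∷ [])) m≡nf) eq)

  ℤ→ℚ-≢0 : ∀ {i} → i ≢ + 0 → ℤ→ℚ i ≢ 0ℚ
  ℤ→ℚ-≢0 i≢0 eq = i≢0 (ℤ→ℚ-injective eq)

  order-9⇒integralModel : ∀ {E} → HasRationalPointOfOrder E 9 → ∃[ m ] ∃[ k ] (let n = + suc k in
    Coprime ℤ.∣ m ∣ ℤ.∣ n ∣ × m ≢ + 0 × m ℤ.- n ≢ + 0 × IsIntegralModel E (integralModel m n))
  order-9⇒integralModel {E} order-9 = let f , f≢0 , f-1≢0 , iso = order-9⇒kubert {E} order-9 in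
    coprime-form f f≢0 f-1≢0 iso
    where
    coprime-form : ∀ f → f ≢ 0ℚ → f - 1ℚ ≢ 0ℚ → equation E ≅ kubert f → ∃[ m ] ∃[ k ] (let n = + suc k in
      Coprime ℤ.∣ m ∣ ℤ.∣ n ∣ × m ≢ + 0 × m ℤ.- n ≢ + 0 × IsIntegralModel E (integralModel m n))
    coprime-form f@(ℚ.mkℚ m k coprime) f≢0 f-1≢0 iso =
      m , k , ℕ.recompute coprime
        , (λ m≡0 → *-≢0 n≢0 f≢0 (trans (sym m≡nf) (cong ℤ→ℚ m≡0)))
        , (λ m-n≡0 → *-≢0 n≢0 f-1≢0 (trans n*[f-1]≡ (cong ℤ→ℚ m-n≡0)))
        , subst (equation E ≅_) (sym (mapW-integralModel m (+ suc k) m≡nf))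
            (≅-scale (equation E) (kubert f) (*-≢0 n≢0 (*-≢0 n≢0 (*-≢0 n≢0 (λ ())))) iso)
      where
      n = + suc k
      m≡nf : ℤ→ℚ m ≡ ℤ→ℚ n * f
      m≡nf = ↥-↧ f
      n≢0 : ℤ→ℚ n ≢ 0ℚ
      n≢0 = ℤ→ℚ-≢0 {n} (λ ())
      n*[f-1]≡ : ℤ→ℚ n * (f - 1ℚ) ≡ ℤ→ℚ (m ℤ.- n)
      n*[f-1]≡ = sym (trans (ℤ→ℚ-+ m (ℤ.- n)) (trans (cong₂ _+_ m≡nf (ℤ→ℚ-neg n))
        (solve 2 (λ n f → n ⊗ f ⊕ ⊝ n ⊜ n ⊗ (f ⊖ Κ (+ 1))) refl (ℤ→ℚ n) f)))

  -- Comparison of two integral models.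

  ℤ→ℚ-^ : ∀ i k → ℤ→ℚ (i ℤ.^ k) ≡ ℤ→ℚ i ^ k
  ℤ→ℚ-^ i zero    = refl
  ℤ→ℚ-^ i (suc k) = trans (ℤ→ℚ-* i (i ℤ.^ k)) (cong (ℤ→ℚ i *_) (ℤ→ℚ-^ i k))

  ^-≢0 : ∀ {q} k → q ≢ 0ℚ → q ^ k ≢ 0ℚ
  ^-≢0 zero    q≢0 = λ ()
  ^-≢0 (suc k) q≢0 = *-≢0 q≢0 (^-≢0 k q≢0)

  -- For isomorphisms from one curve with scalings u and w, the fraction i / j is u / w in lowest
  -- terms.
  record Comparison (W W′ : Weierstrass ℤ) : Set where
    field
      i j     : ℤ
      i≢0     : i ≢ + 0
      j≢0     : j ≢ + 0
      coprime : Coprime ℤ.∣ i ∣ ℤ.∣ j ∣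
      Δ-eq    : i ℤ.^ 12 ℤ.* WeierstrassOver.Δ ℤ-ring W ≡ j ℤ.^ 12 ℤ.* WeierstrassOver.Δ ℤ-ring W′
      c₄-eq   : i ℤ.^ 4 ℤ.* c₄ ℤ-ring W ≡ j ℤ.^ 4 ℤ.* c₄ ℤ-ring W′

  compare : ∀ {E} W W′ → IsIntegralModel E W → IsIntegralModel E W′ → Comparison W W′
  compare {E} W W′ iso@(u , _ , _ , _ , u≢0 , _) iso′@(w , _ , _ , _ , w≢0 , _) = comparison q refl
    where
    w⁻¹ = proj₁ (inverse w≢0)
    q = u * w⁻¹
    qw≡u : q * w ≡ u
    qw≡u = combine (solve 3 (λ u w w⁻¹ → u ⊗ w⁻¹ ⊗ w ⊖ u ⊜ u ⊗ (w ⊗ w⁻¹ ⊖ Κ (+ 1))) refl u w w⁻¹)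
      (u ∙ proj₂ (inverse w≢0))

    -- Generalising over q′ lets numerator and denominator be exposed by matching while the link to
    -- u / w is kept.
    comparison : ∀ q′ → q′ ≡ q → Comparison W W′
    comparison q′@(ℚ.mkℚ i k coprime) q′≡q = record
      { i = i ; j = j
      ; i≢0 = λ i≡0 → u≢0 (trans (sym qw≡u) (trans (cong (_* w) (trans (sym q′≡q) (ℚ.↥p≡0⇒p≡0 q′ i≡0))) (ℚ.*-zeroˡ w)))
      ; j≢0 = λ ()
      ; coprime = ℕ.recompute coprime
      ; Δ-eq = powers 12 (trans (cong (u ^ 12 *_) (Δ-mapW W))
          (trans (trans (Δ-≅ (equation E) (mapW ℤ→ℚ W) iso) (sym (Δ-≅ (equation E) (mapW ℤ→ℚ W′) iso′)))
            (cong (w ^ 12 *_) (sym (Δ-mapW W′)))))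
      ; c₄-eq = powers 4 (trans (cong (u ^ 4 *_) (c₄-mapW W))
          (trans (trans (c₄-≅ (equation E) (mapW ℤ→ℚ W) iso) (sym (c₄-≅ (equation E) (mapW ℤ→ℚ W′) iso′)))
            (cong (w ^ 4 *_) (sym (c₄-mapW W′)))))
      }
      where
      j = + suc k
      powers : ∀ k {x x′} → u ^ k * ℤ→ℚ x ≡ w ^ k * ℤ→ℚ x′ → i ℤ.^ k ℤ.* x ≡ j ℤ.^ k ℤ.* x′
      powers k {x} {x′} eq = ℤ→ℚ-injective (begin
        ℤ→ℚ (i ℤ.^ k ℤ.* x)        ≡⟨ ℤ→ℚ-* (i ℤ.^ k) x ⟩
        ℤ→ℚ (i ℤ.^ k) * ℤ→ℚ x      ≡⟨ cong (_* ℤ→ℚ x) (ℤ→ℚ-^ i k) ⟩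
        ℤ→ℚ i ^ k * ℤ→ℚ x          ≡⟨ combine/ (^-≢0 k w≢0) (solve 7 (λ I J Q U V x x′ →
          V ⊗ (I ⊗ x ⊖ J ⊗ x′) ⊜
          (V ⊗ x) ⊗ (I ⊖ J ⊗ Q) ⊕ (J ⊗ x) ⊗ (Q ⊗ V ⊖ U) ⊕ J ⊗ (U ⊗ x ⊖ V ⊗ x′))
          refl (ℤ→ℚ i ^ k) (ℤ→ℚ j ^ k) (q ^ k) (u ^ k) (w ^ k) (ℤ→ℚ x) (ℤ→ℚ x′))
          ((w ^ k * ℤ→ℚ x) ∙ i^k≡ ⊹ (ℤ→ℚ j ^ k * ℤ→ℚ x) ∙ q^k≡ ⊹ (ℤ→ℚ j ^ k) ∙ eq) ⟩
        ℤ→ℚ j ^ k * ℤ→ℚ x′         ≡⟨ cong (_* ℤ→ℚ x′) (ℤ→ℚ-^ j k) ⟨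
        ℤ→ℚ (j ℤ.^ k) * ℤ→ℚ x′     ≡⟨ ℤ→ℚ-* (j ℤ.^ k) x′ ⟨
        ℤ→ℚ (j ℤ.^ k ℤ.* x′)       ∎)
        where
        open ≡-Reasoning
        i^k≡ : ℤ→ℚ i ^ k ≡ ℤ→ℚ j ^ k * q ^ k
        i^k≡ = trans (cong (_^ k) (trans (↥-↧ q′) (cong (ℤ→ℚ j *_) q′≡q))) (^-distrib-* (ℤ→ℚ j) q k)
        q^k≡ : q ^ k * w ^ k ≡ u ^ k
        q^k≡ = trans (sym (^-distrib-* q w k)) (cong (_^ k) qw≡u)

open OverRationals using (F; Fᴱ; g; integralModel; order-9⇒integralModel; Comparison; compare)

-- Prime divisors of Δ and c₄.

module OverIntegers where
  open import Data.Integer.Base using (_+_; _-_; -_; _*_)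
  open ℤ-Solver using (solve)

  prime-∣⇒≡ : ∀ {p q} → Prime p → Prime q → p ℕ.∣ q → p ≡ q
  prime-∣⇒≡ {p} p-prime q-prime p∣q with prime⇒irreducible q-prime p∣q
  ... | inj₁ refl with () ← ℕ.NonTrivial.nonTrivial (prime⇒nonTrivial p-prime)
  ... | inj₂ p≡q = p≡q

  prime-∣^ : ∀ {p} → Prime p → ∀ a k → p ℕ.∣ a ℕ.^ k → p ℕ.∣ a
  prime-∣^ p-prime a zero p∣1 with refl ← ℕ.∣1⇒≡1 p∣1 | () ← ℕ.NonTrivial.nonTrivial (prime⇒nonTrivial p-prime)
  prime-∣^ p-prime a (suc k) p∣ = [ (λ x → x) , prime-∣^ p-prime a k ]′ (euclidsLemma a (a ℕ.^ k) p-prime p∣)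

  prime-∤-coprime : ∀ {p a b} → Prime p → Coprime a b → p ℕ.∣ a → ¬ p ℕ.∣ b
  prime-∤-coprime p-prime coprime p∣a p∣b
    with refl ← coprime (p∣a , p∣b) | () ← ℕ.NonTrivial.nonTrivial (prime⇒nonTrivial p-prime)

  prime-divisor : ∀ k → k ≢ 0 → k ≢ 1 → ∃[ p ] Prime p × p ℕ.∣ k
  prime-divisor k k≢0 k≢1 with factorise k {{ℕ.≢-nonZero k≢0}}
  ... | record { factors = [] ; isFactorisation = k≡1 } = ⊥-elim (k≢1 k≡1)
  ... | record { factors = p ∷ ps ; isFactorisation = refl ; factorsPrime = p-prime ∷ _ } =
    p , p-prime , ℕ.m∣m*n _

  only-prime-3 : ∀ k → k ≢ 0 → ¬ 9 ℕ.∣ k → k ≡ 1 ⊎ k ≡ 3 ⊎ ∃[ q ] Prime q × q ≢ 3 × q ℕ.∣ k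
  only-prime-3 k k≢0 9∤k with k ℕ.≟ 1 | 3 ℕ.∣? k
  ... | yes k≡1 | _ = inj₁ k≡1
  ... | no k≢1 | no 3∤k = let q , q-prime , q∣k = prime-divisor k k≢0 k≢1 in
    inj₂ (inj₂ (q , q-prime , (λ q≡3 → 3∤k (subst (ℕ._∣ k) q≡3 q∣k)) , q∣k))
  ... | no k≢1 | yes (ℕ.divides j refl) with j ℕ.≟ 1
  ... | yes refl = inj₂ (inj₁ refl)
  ... | no j≢1 = let q , q-prime , q∣j = prime-divisor j (λ { refl → k≢0 refl }) j≢1 in
    inj₂ (inj₂ (q , q-prime , (λ q≡3 → 9∤k (ℕ.*-monoˡ-∣ 3 (subst (ℕ._∣ j) q≡3 q∣j))) , ℕ.∣m⇒∣m*n 3 q∣j))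

  module _ {p : ℕ} (p-prime : Prime p) where

    euclid : ∀ {i j} → + p ∣ᶻ i * j → + p ∣ᶻ i ⊎ + p ∣ᶻ j
    euclid {i} {j} p∣ij = [ inj₁ ∘ ∣ᵤ⇒∣ , inj₂ ∘ ∣ᵤ⇒∣ ]′
      (euclidsLemma ∣ i ∣ ∣ j ∣ p-prime (subst (p ℕ.∣_) (ℤ.abs-* i j) (∣⇒∣ᵤ p∣ij)))

    euclid² : ∀ {i} → + p ∣ᶻ i * i → + p ∣ᶻ i
    euclid² = [ (λ x → x) , (λ x → x) ]′ ∘ euclid

  module _ {p : ℕ} (a₁ a₂ a₃ : ℤ) (p∣a₃ : + p ∣ᶻ a₃) where

    private W = weierstrass a₁ a₂ a₃ (+ 0) (+ 0)

    -- As a₄ = a₆ = 0, the point (0 , 0) becomes singular modulo p. Explicitly, b₄, b₆ and b₈ are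
    -- multiples of a₃.
    ∣a₃⇒∣Δ : + p ∣ᶻ WeierstrassOver.Δ ℤ-ring W
    ∣a₃⇒∣Δ = subst (+ p ∣ᶻ_) (solve 3 (λ a₁ a₂ a₃ →
        let W = weierstrass a₁ a₂ a₃ (Κ (+ 0)) (Κ (+ 0))
            open WeierstrassExpr W using (b₂ᴱ; b₄ᴱ; b₆ᴱ)
        in
        a₃ ⊗ (9 ·ᴱ (b₂ᴱ ⊗ a₁ ⊗ b₆ᴱ) ⊖ b₂ᴱ ^ᴱ 2 ⊗ (a₂ ⊗ a₃) ⊖ 8 ·ᴱ (a₁ ⊗ b₄ᴱ ^ᴱ 2) ⊖ 27 ·ᴱ (a₃ ⊗ b₆ᴱ)) ⊜ Δᴱ W)
        refl a₁ a₂ a₃) (∣m⇒∣m*n _ p∣a₃)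

    -- Modulo p the quadratic part at (0 , 0) is Y (Y + a₁ X), with distinct factors, and c₄ is a₁⁴.
    ∤a₁⇒∤c₄ : Prime p → ¬ + p ∣ᶻ a₁ → + p ∣ᶻ a₂ → ¬ + p ∣ᶻ c₄ ℤ-ring W
    ∤a₁⇒∤c₄ p-prime p∤a₁ p∣a₂ p∣c₄ = p∤a₁ (euclid² p-prime (euclid² p-prime (subst (+ p ∣ᶻ_)
      (solve 3 (λ a₁ a₂ a₃ →
        c₄ᴱ (weierstrass a₁ a₂ a₃ (Κ (+ 0)) (Κ (+ 0))) ⊖ (a₂ ⊗ (8 ·ᴱ a₁ ^ᴱ 2 ⊕ 16 ·ᴱ a₂) ⊖ a₃ ⊗ (24 ·ᴱ a₁))
        ⊜ a₁ ⊗ a₁ ⊗ (a₁ ⊗ a₁))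
        refl a₁ a₂ a₃)
      (∣m∣n⇒∣m-n p∣c₄ (∣m∣n⇒∣m-n (∣m⇒∣m*n _ p∣a₂) (∣m⇒∣m*n _ p∣a₃))))))

  ∣-^* : ∀ i k x → ∣ i ℤ.^ k * x ∣ ≡ ∣ i ∣ ℕ.^ k ℕ.* ∣ x ∣
  ∣-^* i k x = trans (ℤ.abs-* (i ℤ.^ k) x) (cong (ℕ._* ∣ x ∣) (abs-^ k))
    where
    abs-^ : ∀ k → ∣ i ℤ.^ k ∣ ≡ ∣ i ∣ ℕ.^ k
    abs-^ zero    = refl
    abs-^ (suc k) = trans (ℤ.abs-* i (i ℤ.^ k)) (cong (∣ i ∣ ℕ.*_) (abs-^ k))

  -- Otherwise p divides i, hence not j, and hence p divides c₄ of W′.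
  comparison-∣Δ : ∀ {W W′ p} → Comparison W W′ → Prime p →
    + p ∣ᶻ WeierstrassOver.Δ ℤ-ring W′ → ¬ + p ∣ᶻ c₄ ℤ-ring W′ → p ℕ.∣ ∣ WeierstrassOver.Δ ℤ-ring W ∣
  comparison-∣Δ {W} {W′} {p} C p-prime p∣Δ p∤c₄
    with p ℕ.∣? ∣ WeierstrassOver.Δ ℤ-ring W ∣
  ... | yes p∣ = p∣
  ... | no  p∤ = ⊥-elim (p∤c₄ (∣ᵤ⇒∣ p∣c₄))
    where
    open Comparison C
    Δ : ℤ
    Δ = WeierstrassOver.Δ ℤ-ring W
    p∣i : p ℕ.∣ ∣ i ∣
    p∣i = prime-∣^ p-prime ∣ i ∣ 12 ([ (λ x → x) , ⊥-elim ∘ p∤ ]′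
      (euclidsLemma (∣ i ∣ ℕ.^ 12) ∣ Δ ∣ p-prime
        (subst (p ℕ.∣_) (trans (cong ∣_∣ (sym Δ-eq)) (∣-^* i 12 Δ)) (∣⇒∣ᵤ (∣n⇒∣m*n (j ℤ.^ 12) p∣Δ)))))
    p∣c₄ : p ℕ.∣ ∣ c₄ ℤ-ring W′ ∣
    p∣c₄ = [ ⊥-elim ∘ prime-∤-coprime p-prime coprime p∣i ∘ prime-∣^ p-prime ∣ j ∣ 4 , (λ x → x) ]′
      (euclidsLemma (∣ j ∣ ℕ.^ 4) ∣ c₄ ℤ-ring W′ ∣ p-prime
        (subst (p ℕ.∣_) (trans (sym (∣-^* i 4 (c₄ ℤ-ring W))) (trans (cong ∣_∣ c₄-eq) (∣-^* j 4 (c₄ ℤ-ring W′))))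
          (ℕ.∣m⇒∣m*n _ (ℕ.∣-trans p∣i (ℕ.m∣m*n _)))))

  prime[3] : Prime 3
  prime[3] = from-yes (prime? 3)

  2∤⇒2∣-1 : ∀ {i} → ¬ + 2 ∣ᶻ i → + 2 ∣ᶻ i - + 1
  2∤⇒2∣-1 {i} 2∤i with i ℤ.%ℕ 2 | ℤ.n%ℕd<d i 2 | ℤ.a≡a%ℕn+[a/ℕn]*n i 2
  ... | 0 | _ | eq = ⊥-elim (2∤i (divides (i ℤ./ℕ 2) (trans eq (ℤ.+-identityˡ _))))
  ... | 1 | _ | eq = divides (i ℤ./ℕ 2) (trans (cong (_- + 1) eq)
    (solve 1 (λ x → Κ (+ 1) ⊕ x ⊖ Κ (+ 1) ⊜ x) refl (i ℤ./ℕ 2 * + 2)))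
  ... | suc (suc _) | s≤s (s≤s ()) | _

  2∤⇒2∣- : ∀ {i j} → ¬ + 2 ∣ᶻ i → ¬ + 2 ∣ᶻ j → + 2 ∣ᶻ i - j
  2∤⇒2∣- {i} {j} 2∤i 2∤j = subst (+ 2 ∣ᶻ_)
    (solve 2 (λ i j → i ⊖ Κ (+ 1) ⊖ (j ⊖ Κ (+ 1)) ⊜ i ⊖ j) refl i j)
    (∣m∣n⇒∣m-n (2∤⇒2∣-1 2∤i) (2∤⇒2∣-1 2∤j))

  -- Arithmetic of m, n, m - n and F.

  module Coprimality {m n : ℤ} (coprime : Coprime ∣ m ∣ ∣ n ∣) where

    module _ {p : ℕ} (p-prime : Prime p) where

      not-both : + p ∣ᶻ m → ¬ + p ∣ᶻ n
      not-both p∣m p∣n = prime-∤-coprime p-prime coprime (∣⇒∣ᵤ p∣m) (∣⇒∣ᵤ p∣n)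

      ∣m∧∣m-n⇒⊥ : + p ∣ᶻ m → ¬ + p ∣ᶻ m - n
      ∣m∧∣m-n⇒⊥ p∣m p∣m-n = not-both p∣m
        (subst (+ p ∣ᶻ_) (solve 2 (λ m n → m ⊖ (m ⊖ n) ⊜ n) refl m n) (∣m∣n⇒∣m-n p∣m p∣m-n))

      ∣n∧∣m-n⇒⊥ : + p ∣ᶻ n → ¬ + p ∣ᶻ m - n
      ∣n∧∣m-n⇒⊥ p∣n p∣m-n = not-both
        (subst (+ p ∣ᶻ_) (solve 2 (λ m n → m ⊖ n ⊕ n ⊜ m) refl m n) (∣m∣n⇒∣m+n p∣m-n p∣n)) p∣n

      -- Modulo m, n and m - n, F is n², m² and m n. This lemma and the next two make F prime to m n
      -- (m - n).
      ∣m⇒∤F : + p ∣ᶻ m → ¬ + p ∣ᶻ F m n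
      ∣m⇒∤F p∣m p∣F = not-both p∣m (euclid² p-prime (subst (+ p ∣ᶻ_)
        (solve 2 (λ m n → Fᴱ m n ⊖ m ⊗ (m ⊖ n) ⊜ n ⊗ n) refl m n) (∣m∣n⇒∣m-n p∣F (∣m⇒∣m*n _ p∣m))))

      ∣n⇒∤F : + p ∣ᶻ n → ¬ + p ∣ᶻ F m n
      ∣n⇒∤F p∣n p∣F = not-both (euclid² p-prime (subst (+ p ∣ᶻ_)
        (solve 2 (λ m n → Fᴱ m n ⊖ n ⊗ (n ⊖ m) ⊜ m ⊗ m) refl m n) (∣m∣n⇒∣m-n p∣F (∣m⇒∣m*n _ p∣n)))) p∣n

      ∣m-n⇒∤F : + p ∣ᶻ m - n → ¬ + p ∣ᶻ F m n
      ∣m-n⇒∤F p∣m-n p∣F =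
        [ (λ p∣m → ∣m⇒∤F p∣m p∣F) , (λ p∣n → ∣n⇒∤F p∣n p∣F) ]′ (euclid p-prime (subst (+ p ∣ᶻ_)
          (solve 2 (λ m n → Fᴱ m n ⊖ (m ⊖ n) ⊗ (m ⊖ n) ⊜ m ⊗ n) refl m n)
          (∣m∣n⇒∣m-n p∣F (∣m⇒∣m*n (m - n) p∣m-n))))

      private
        a₁ = n * n * n - m * m * (m - n)

      ∣m⇒∤a₁ : + p ∣ᶻ m → ¬ + p ∣ᶻ a₁
      ∣m⇒∤a₁ p∣m p∣a₁ = not-both p∣m ([ euclid² p-prime , (λ x → x) ]′ (euclid p-prime (subst (+ p ∣ᶻ_)
        (solve 2 (λ m n → n ⊗ n ⊗ n ⊖ m ⊗ m ⊗ (m ⊖ n) ⊕ m ⊗ (m ⊗ (m ⊖ n)) ⊜ n ⊗ n ⊗ n) refl m n)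
        (∣m∣n⇒∣m+n p∣a₁ (∣m⇒∣m*n _ p∣m)))))

      ∣n⇒∤a₁ : + p ∣ᶻ n → ¬ + p ∣ᶻ a₁
      ∣n⇒∤a₁ p∣n p∣a₁ = [ (λ p∣mm → not-both (euclid² p-prime p∣mm) p∣n) , ∣n∧∣m-n⇒⊥ p∣n ]′
        (euclid p-prime (subst (+ p ∣ᶻ_)
          (solve 2 (λ m n → n ⊗ (n ⊗ n) ⊖ (n ⊗ n ⊗ n ⊖ m ⊗ m ⊗ (m ⊖ n)) ⊜ m ⊗ m ⊗ (m ⊖ n)) refl m n)
          (∣m∣n⇒∣m-n (∣m⇒∣m*n (n * n) p∣n) p∣a₁)))

      ∣m-n⇒∤a₁ : + p ∣ᶻ m - n → ¬ + p ∣ᶻ a₁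
      ∣m-n⇒∤a₁ p∣m-n p∣a₁ = ∣n∧∣m-n⇒⊥ ([ euclid² p-prime , (λ x → x) ]′ (euclid p-prime (subst (+ p ∣ᶻ_)
        (solve 2 (λ m n → n ⊗ n ⊗ n ⊖ m ⊗ m ⊗ (m ⊖ n) ⊕ m ⊗ m ⊗ (m ⊖ n) ⊜ n ⊗ n ⊗ n) refl m n)
        (∣m∣n⇒∣m+n p∣a₁ (∣n⇒∣m*n (m * m) p∣m-n))))) p∣m-n

      -- Modulo F, a₁ is m² (n - 2m) and (n - 2m)² is 3m (m - n).
      ∣F⇒∤a₁ : p ≢ 3 → + p ∣ᶻ F m n → ¬ + p ∣ᶻ a₁
      ∣F⇒∤a₁ p≢3 p∣F p∣a₁ = [ (λ p∣mm → p∤m (euclid² p-prime p∣mm)) , p∤n-2m ]′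
        (euclid p-prime (subst (+ p ∣ᶻ_)
          (solve 2 (λ m n → n ⊗ n ⊗ n ⊖ m ⊗ m ⊗ (m ⊖ n) ⊖ (m ⊕ n) ⊗ Fᴱ m n ⊜ m ⊗ m ⊗ (n ⊖ Κ (+ 2) ⊗ m)) refl m n)
          (∣m∣n⇒∣m-n p∣a₁ (∣n⇒∣m*n (m + n) p∣F))))
        where
        p∤m : ¬ + p ∣ᶻ m
        p∤m p∣m = ∣m⇒∤F p∣m p∣F
        p∤n-2m : ¬ + p ∣ᶻ n - + 2 * m
        p∤n-2m p∣n-2m = [ [ p≢3 ∘ prime-∣⇒≡ p-prime prime[3] ∘ ∣⇒∣ᵤ , p∤m ]′ ∘ euclid p-prime {+ 3} {m}
                        , (λ p∣m-n → ∣m-n⇒∤F p∣m-n p∣F) ]′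
          (euclid p-prime {+ 3 * m} {m - n} (subst (+ p ∣ᶻ_)
            (solve 2 (λ m n → (n ⊖ Κ (+ 2) ⊗ m) ⊗ (n ⊖ Κ (+ 2) ⊗ m) ⊖ Fᴱ m n ⊜ Κ (+ 3) ⊗ m ⊗ (m ⊖ n)) refl m n)
            (∣m∣n⇒∣m-n (∣m⇒∣m*n (n - + 2 * m) p∣n-2m) p∣F)))

    -- F = (m + n)² - 3 m n. If 3 divides F it divides m + n, so 9 dividing F would make 3 divide m
    -- n, to which F is prime.
    9∤F : ¬ + 9 ∣ᶻ F m n
    9∤F 9∣F = [ (λ 3∣m → ∣m⇒∤F prime[3] 3∣m 3∣F) , (λ 3∣n → ∣n⇒∤F prime[3] 3∣n 3∣F) ]′
      (euclid prime[3] (*-cancelˡ-∣ (+ 3) 9∣3mn))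
      where
      3∣F : + 3 ∣ᶻ F m n
      3∣F = ∣-trans (divides (+ 3) refl) 9∣F
      3∣m+n : + 3 ∣ᶻ m + n
      3∣m+n = euclid² prime[3] (subst (+ 3 ∣ᶻ_)
        (solve 2 (λ m n → Fᴱ m n ⊕ Κ (+ 3) ⊗ (m ⊗ n) ⊜ (m ⊕ n) ⊗ (m ⊕ n)) refl m n)
        (∣m∣n⇒∣m+n 3∣F (∣m⇒∣m*n (m * n) (divides (+ 1) refl))))
      9∣3mn : + 9 ∣ᶻ + 3 * (m * n)
      9∣3mn = subst (+ 9 ∣ᶻ_)
        (solve 2 (λ m n → (m ⊕ n) ⊗ (m ⊕ n) ⊖ Fᴱ m n ⊜ Κ (+ 3) ⊗ (m ⊗ n)) refl m n)
        (∣m∣n⇒∣m-n (square-9 3∣m+n) 9∣F)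
        where
        square-9 : ∀ {i} → + 3 ∣ᶻ i → + 9 ∣ᶻ i * i
        square-9 (divides q refl) = divides (q * q)
          (solve 1 (λ q → q ⊗ Κ (+ 3) ⊗ (q ⊗ Κ (+ 3)) ⊜ q ⊗ q ⊗ Κ (+ 9)) refl q)

    -- One of m, n and m - n is even, and F is prime to each of them.
    2∤F : ¬ + 2 ∣ᶻ F m n
    2∤F 2∣F with + 2 ∣? m | + 2 ∣? n
    ... | yes 2∣m | _       = ∣m⇒∤F prime[2] 2∣m 2∣F
    ... | no _    | yes 2∣n = ∣n⇒∤F prime[2] 2∣n 2∣F
    ... | no 2∤m  | no 2∤n  = ∣m-n⇒∤F prime[2] (2∤⇒2∣- 2∤m 2∤n) 2∣F

    -- The primes modulo which integralModel m n has a node at (0 , 0).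
    data NodePrime (p : ℕ) : Set where
      ∣m   : + p ∣ᶻ m → NodePrime p
      ∣n   : + p ∣ᶻ n → NodePrime p
      ∣m-n : + p ∣ᶻ m - n → NodePrime p
      ∣F   : p ≢ 3 → + p ∣ᶻ F m n → NodePrime p

    nodePrime⇒∣g : ∀ {p} → NodePrime p → + p ∣ᶻ n * g m n
    nodePrime⇒∣g (∣m p∣m)     = ∣n⇒∣m*n n (∣m⇒∣m*n (F m n) (∣m⇒∣m*n (m - n) (∣m⇒∣m*n m p∣m)))
    nodePrime⇒∣g (∣n p∣n)     = ∣m⇒∣m*n (g m n) p∣n
    nodePrime⇒∣g (∣m-n p∣m-n) = ∣n⇒∣m*n n (∣m⇒∣m*n (F m n) (∣n⇒∣m*n (m * m) p∣m-n))
    nodePrime⇒∣g (∣F _ p∣F)   = ∣n⇒∣m*n n (∣n⇒∣m*n (m * m * (m - n)) p∣F)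

    nodePrime⇒∤a₁ : ∀ {p} → Prime p → NodePrime p → ¬ + p ∣ᶻ Weierstrass.a₁ (integralModel m n)
    nodePrime⇒∤a₁ p-prime (∣m p∣m)     = ∣m⇒∤a₁ p-prime p∣m
    nodePrime⇒∤a₁ p-prime (∣n p∣n)     = ∣n⇒∤a₁ p-prime p∣n
    nodePrime⇒∤a₁ p-prime (∣m-n p∣m-n) = ∣m-n⇒∤a₁ p-prime p∣m-n
    nodePrime⇒∤a₁ p-prime (∣F p≢3 p∣F) = ∣F⇒∤a₁ p-prime p≢3 p∣F

    nodePrime⇒∣Δ : ∀ {W p} → Comparison W (integralModel m n) → Prime p → NodePrime p →
      p ℕ.∣ ∣ WeierstrassOver.Δ ℤ-ring W ∣
    nodePrime⇒∣Δ {W} {p} C p-prime node = comparison-∣Δ C p-prime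

      (∣a₃⇒∣Δ a₁ a₂ a₃ p∣a₃) (∤a₁⇒∤c₄ a₁ a₂ a₃ p∣a₃ p-prime (nodePrime⇒∤a₁ p-prime node) p∣a₂)
      where
      open Weierstrass (integralModel m n) using (a₁; a₂; a₃)
      p∣a₂ : + p ∣ᶻ - (n * g m n)
      p∣a₂ = ∣m⇒∣-m (nodePrime⇒∣g node)
      p∣a₃ : + p ∣ᶻ - (n * n * n * n * g m n)
      p∣a₃ = ∣m⇒∣-m (subst (+ p ∣ᶻ_)
        (solve 2 (λ n g → n ⊗ n ⊗ n ⊗ (n ⊗ g) ⊜ n ⊗ n ⊗ n ⊗ n ⊗ g) refl n (g m n))
        (∣n⇒∣m*n (n * n * n) (nodePrime⇒∣g node)))

  -- Two bad primes determine F.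

  unit : ∀ {i} → ∣ i ∣ ≡ 1 → i ≡ + 1 ⊎ i ≡ -[1+ 0 ]
  unit {+ 1}       refl = inj₁ refl
  unit { -[1+ 0 ]} refl = inj₂ refl

  only-2-odd⇒unit : ∀ {i} → i ≢ + 0 → (∀ {r} → Prime r → + r ∣ᶻ i → r ≡ 2) → ¬ + 2 ∣ᶻ i →
    i ≡ + 1 ⊎ i ≡ -[1+ 0 ]
  only-2-odd⇒unit {i} i≢0 only-2 2∤i with ∣ i ∣ ℕ.≟ 1
  ... | yes ∣i∣≡1 = unit ∣i∣≡1
  ... | no ∣i∣≢1 =
    let r , r-prime , r∣i = prime-divisor ∣ i ∣ (i≢0 ∘ ℤ.∣i∣≡0⇒i≡0) ∣i∣≢1
    in ⊥-elim (2∤i (subst (λ r → + r ∣ᶻ i) (only-2 r-prime (∣ᵤ⇒∣ r∣i)) (∣ᵤ⇒∣ r∣i)))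

  ∣F∣-of-units : ∀ {x y z} → x ≡ + 1 ⊎ x ≡ -[1+ 0 ] → y ≡ + 1 ⊎ y ≡ -[1+ 0 ] →
    z ≡ x * x - x * y + y * y → ∣ z ∣ ≡ 1 ⊎ ∣ z ∣ ≡ 3
  ∣F∣-of-units (inj₁ refl) (inj₁ refl) refl = inj₁ refl
  ∣F∣-of-units (inj₁ refl) (inj₂ refl) refl = inj₂ refl
  ∣F∣-of-units (inj₂ refl) (inj₁ refl) refl = inj₂ refl
  ∣F∣-of-units (inj₂ refl) (inj₂ refl) refl = inj₁ refl

  module _ {m n : ℤ} (coprime : Coprime ∣ m ∣ ∣ n ∣) (m≢0 : m ≢ + 0) (n≢0 : n ≢ + 0) (m-n≢0 : m - n ≢ + 0) where
    open Coprimality {m} {n} coprime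

    nodePrime-2 : NodePrime 2
    nodePrime-2 with + 2 ∣? m | + 2 ∣? n
    ... | yes 2∣m | _       = ∣m 2∣m
    ... | no _    | yes 2∣n = ∣n 2∣n
    ... | no 2∤m  | no 2∤n  = ∣m-n (2∤⇒2∣- 2∤m 2∤n)

    -- If a prime l ≢ 3 divides F, then 2 and l are all the node primes, so that
    -- m, n and m - n are up to sign powers of 2.
    module _ {p q l : ℕ} (two-primes : ∀ {r} → Prime r → NodePrime r → r ≡ p ⊎ r ≡ q)
      (l-prime : Prime l) (l≢3 : l ≢ 3) (l∣F : + l ∣ᶻ F m n) where

      2≢l : 2 ≢ l
      2≢l refl = 2∤F l∣F

      2-or-l : ∀ {r} → Prime r → NodePrime r → r ≡ 2 ⊎ r ≡ l
      2-or-l r-prime node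
        with two-primes prime[2] nodePrime-2 | two-primes l-prime (∣F l≢3 l∣F) | two-primes r-prime node
      ... | inj₁ 2≡p | inj₁ l≡p | _        = ⊥-elim (2≢l (trans 2≡p (sym l≡p)))
      ... | inj₂ 2≡q | inj₂ l≡q | _        = ⊥-elim (2≢l (trans 2≡q (sym l≡q)))
      ... | inj₁ 2≡p | inj₂ l≡q | inj₁ r≡p = inj₁ (trans r≡p (sym 2≡p))
      ... | inj₁ 2≡p | inj₂ l≡q | inj₂ r≡q = inj₂ (trans r≡q (sym l≡q))
      ... | inj₂ 2≡q | inj₁ l≡p | inj₁ r≡p = inj₂ (trans r≡p (sym l≡p))
      ... | inj₂ 2≡q | inj₁ l≡p | inj₂ r≡q = inj₁ (trans r≡q (sym 2≡q))

      only-2 : ∀ {r} → Prime r → NodePrime r → ¬ + r ∣ᶻ F m n → r ≡ 2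
      only-2 r-prime node r∤F = [ (λ x → x) , (λ { refl → ⊥-elim (r∤F l∣F) }) ]′ (2-or-l r-prime node)

      m-unit : ¬ + 2 ∣ᶻ m → m ≡ + 1 ⊎ m ≡ -[1+ 0 ]
      m-unit = only-2-odd⇒unit m≢0 (λ r-prime r∣m → only-2 r-prime (∣m r∣m) (∣m⇒∤F r-prime r∣m))
      n-unit : ¬ + 2 ∣ᶻ n → n ≡ + 1 ⊎ n ≡ -[1+ 0 ]
      n-unit = only-2-odd⇒unit n≢0 (λ r-prime r∣n → only-2 r-prime (∣n r∣n) (∣n⇒∤F r-prime r∣n))
      m-n-unit : ¬ + 2 ∣ᶻ m - n → m - n ≡ + 1 ⊎ m - n ≡ -[1+ 0 ]
      m-n-unit = only-2-odd⇒unit m-n≢0 (λ r-prime r∣m-n → only-2 r-prime (∣m-n r∣m-n) (∣m-n⇒∤F r-prime r∣m-n))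

      negate : ∀ {i} → i ≡ + 1 ⊎ i ≡ -[1+ 0 ] → - i ≡ + 1 ⊎ - i ≡ -[1+ 0 ]
      negate (inj₁ refl) = inj₂ refl
      negate (inj₂ refl) = inj₁ refl

      -- The two odd numbers among m, n, m - n are ±1. Written as x² - xy + y², F takes the pair (m
      -- , n), (n , n - m) or (m , m - n), according to which number is even.
      l∣F⇒∣F∣≡1∨3 : ∣ F m n ∣ ≡ 1 ⊎ ∣ F m n ∣ ≡ 3
      l∣F⇒∣F∣≡1∨3 = by-parity (+ 2 ∣? m) (+ 2 ∣? n)
        where
        by-parity : Dec (+ 2 ∣ᶻ m) → Dec (+ 2 ∣ᶻ n) → ∣ F m n ∣ ≡ 1 ⊎ ∣ F m n ∣ ≡ 3
        by-parity (yes 2∣m) _ = ∣F∣-of-units (n-unit (not-both prime[2] 2∣m))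
          (negate (m-n-unit (∣m∧∣m-n⇒⊥ prime[2] 2∣m)))
          (solve 2 (λ m n → Fᴱ m n ⊜ n ⊗ n ⊖ n ⊗ (⊝ (m ⊖ n)) ⊕ (⊝ (m ⊖ n)) ⊗ (⊝ (m ⊖ n))) refl m n)
        by-parity (no 2∤m) (yes 2∣n) = ∣F∣-of-units (m-unit 2∤m) (m-n-unit (∣n∧∣m-n⇒⊥ prime[2] 2∣n))
          (solve 2 (λ m n → Fᴱ m n ⊜ m ⊗ m ⊖ m ⊗ (m ⊖ n) ⊕ (m ⊖ n) ⊗ (m ⊖ n)) refl m n)
        by-parity (no 2∤m) (no 2∤n) = ∣F∣-of-units (m-unit 2∤m) (n-unit 2∤n) refl

    ∣F∣≡1∨3 : ∀ {p q} → (∀ {r} → Prime r → NodePrime r → r ≡ p ⊎ r ≡ q) → ∣ F m n ∣ ≡ 1 ⊎ ∣ F m n ∣ ≡ 3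
    ∣F∣≡1∨3 two-primes =
      [ inj₁
      , [ inj₂ , (λ (l , l-prime , l≢3 , l∣F) → l∣F⇒∣F∣≡1∨3 two-primes l-prime l≢3 (∣ᵤ⇒∣ l∣F)) ]′ ]′
      (only-prime-3 ∣ F m n ∣
        (λ ∣F∣≡0 → 2∤F (subst (+ 2 ∣ᶻ_) (sym (ℤ.∣i∣≡0⇒i≡0 ∣F∣≡0)) (divides (+ 0) refl)))
        (9∤F ∘ ∣ᵤ⇒∣))

  -- Finitely many parameters.

  *-self : ∀ i → i * i ≡ + (∣ i ∣ ℕ.* ∣ i ∣)
  *-self (+ i)    = ℤ.+◃n≡+n (i ℕ.* i)
  *-self -[1+ i ] = refl

  -- Stated for general x and y because 4F = 3m² + (m - 2n)² = 3n² + (n - 2m)² is used both ways, to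
  -- bound m and n.
  3x²≤4∣F∣ : ∀ x y z → + 4 * z ≡ + 3 * (x * x) + y * y → 3 ℕ.* (∣ x ∣ ℕ.* ∣ x ∣) ℕ.≤ 4 ℕ.* ∣ z ∣
  3x²≤4∣F∣ x y z eq = begin
    3 ℕ.* (∣ x ∣ ℕ.* ∣ x ∣)                               ≤⟨ ℕ.m≤m+n _ _ ⟩
    3 ℕ.* (∣ x ∣ ℕ.* ∣ x ∣) ℕ.+ ∣ y ∣ ℕ.* ∣ y ∣           ≡⟨ cong ∣_∣ (trans (ℤ.pos-+ (3 ℕ.* (∣ x ∣ ℕ.* ∣ x ∣)) (∣ y ∣ ℕ.* ∣ y ∣))
        (cong₂ _+_ (trans (ℤ.pos-* 3 (∣ x ∣ ℕ.* ∣ x ∣)) (cong (+ 3 *_) (sym (*-self x)))) (sym (*-self y)))) ⟩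
    ∣ + 3 * (x * x) + y * y ∣                              ≡⟨ cong ∣_∣ eq ⟨
    ∣ + 4 * z ∣                                            ≡⟨ ℤ.abs-* (+ 4) z ⟩
    4 ℕ.* ∣ z ∣                                            ∎
    where open ℕ.≤-Reasoning

  ∣x∣≤2 : ∀ {x} → 3 ℕ.* (x ℕ.* x) ℕ.≤ 12 → x ℕ.≤ 2
  ∣x∣≤2 {x} 3x²≤12 with x ℕ.≤? 2
  ... | yes x≤2 = x≤2
  ... | no  x≰2 = contradiction (ℕ.≤-trans (ℕ.*-monoʳ-≤ 3 (ℕ.*-mono-≤ x≥3 x≥3)) 3x²≤12) (from-no (27 ℕ.≤? 12))
    where x≥3 = ℕ.≰⇒> x≰2

  -- The parameters f = 1/2, 2 and -1 form one orbit of f ↦ 1 / (1 - f), that is of (m , n) ↦ (n , n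
  -- - m), which preserves F.
  data Exceptional : ℤ → ℤ → Set where
    1,2  : Exceptional (+ 1) (+ 2)
    2,1  : Exceptional (+ 2) (+ 1)
    -1,1 : Exceptional -[1+ 0 ] (+ 1)

  ∣F∣≡1∨3⇒exceptional : ∀ m k → (let n = + suc k) → m ≢ + 0 → m - n ≢ + 0 →
    ∣ F m n ∣ ≡ 1 ⊎ ∣ F m n ∣ ≡ 3 → Exceptional m n
  ∣F∣≡1∨3⇒exceptional m k m≢0 m-n≢0 ∣F∣≡1∨3 = search m k
    (bound m (m - + 2 * n) (solve 2 (λ m n → Κ (+ 4) ⊗ Fᴱ m n ⊜
      Κ (+ 3) ⊗ (m ⊗ m) ⊕ (m ⊖ Κ (+ 2) ⊗ n) ⊗ (m ⊖ Κ (+ 2) ⊗ n)) refl m n))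
    (bound n (n - + 2 * m) (solve 2 (λ m n → Κ (+ 4) ⊗ Fᴱ m n ⊜
      Κ (+ 3) ⊗ (n ⊗ n) ⊕ (n ⊖ Κ (+ 2) ⊗ m) ⊗ (n ⊖ Κ (+ 2) ⊗ m)) refl m n))
    m≢0 m-n≢0 ∣F∣≡1∨3
    where
    n = + suc k
    ∣F∣≤3 : ∣ F m n ∣ ℕ.≤ 3
    ∣F∣≤3 = [ (λ eq → ℕ.≤-trans (ℕ.≤-reflexive eq) (s≤s z≤n)) , ℕ.≤-reflexive ]′ ∣F∣≡1∨3
    bound : ∀ x y → + 4 * F m n ≡ + 3 * (x * x) + y * y → ∣ x ∣ ℕ.≤ 2
    bound x y eq = ∣x∣≤2 (ℕ.≤-trans (3x²≤4∣F∣ x y (F m n) eq) (ℕ.*-monoʳ-≤ 4 ∣F∣≤3))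

    search : ∀ m k → ∣ m ∣ ℕ.≤ 2 → suc k ℕ.≤ 2 → m ≢ + 0 → m - + suc k ≢ + 0 →
      ∣ F m (+ suc k) ∣ ≡ 1 ⊎ ∣ F m (+ suc k) ∣ ≡ 3 → Exceptional m (+ suc k)
    search (+ 0) _ _ _ m≢0 _ _ = ⊥-elim (m≢0 refl)
    search (+ 1) 0 _ _ _ m-n≢0 _ = ⊥-elim (m-n≢0 refl)
    search (+ 1) 1 _ _ _ _ _ = 1,2
    search (+ 2) 0 _ _ _ _ _ = 2,1
    search (+ 2) 1 _ _ _ m-n≢0 _ = ⊥-elim (m-n≢0 refl)
    search -[1+ 0 ] 0 _ _ _ _ _ = -1,1
    -- For (-1 , 2), (-2 , 1) and (-2 , 2) the value of F is 7, 7 and 12.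
    search -[1+ 0 ] 1 _ _ _ _ (inj₁ ())
    search -[1+ 0 ] 1 _ _ _ _ (inj₂ ())
    search -[1+ 1 ] 0 _ _ _ _ (inj₁ ())
    search -[1+ 1 ] 0 _ _ _ _ (inj₂ ())
    search -[1+ 1 ] 1 _ _ _ _ (inj₁ ())
    search -[1+ 1 ] 1 _ _ _ _ (inj₂ ())
    search _ (suc (suc _)) _ (s≤s (s≤s ())) _ _ _
    search (+ suc (suc (suc _))) _ (s≤s (s≤s ())) _ _ _ _
    search -[1+ suc (suc _) ] _ (s≤s (s≤s ())) _ _ _ _

  exceptional-Δ : ∀ {m n} → Exceptional m n → WeierstrassOver.Δ ℤ-ring (integralModel m n) ≡ - + 124416
  exceptional-Δ 1,2  = refl
  exceptional-Δ 2,1  = refl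
  exceptional-Δ -1,1 = refl

  exceptional-c₄ : ∀ {m n} → Exceptional m n → + 3 ∣ᶻ c₄ ℤ-ring (integralModel m n)
  exceptional-c₄ 1,2  = from-yes (+ 3 ∣? c₄ ℤ-ring (integralModel (+ 1) (+ 2)))
  exceptional-c₄ 2,1  = from-yes (+ 3 ∣? c₄ ℤ-ring (integralModel (+ 2) (+ 1)))
  exceptional-c₄ -1,1 = from-yes (+ 3 ∣? c₄ ℤ-ring (integralModel -[1+ 0 ] (+ 1)))

-- Minimal discriminant and conductor.

open OverIntegers
open import Data.Integer.Base using (-_)
open import Data.Nat.Base using (_*_; _^_; _<_)
open ℤ-Solver using (solve)

coprime-*ˡ : ∀ {a b c} → Coprime a c → Coprime b c → Coprime (a * b) c
coprime-*ˡ {a} {b} {c} a-c b-c {d} (d∣ab , d∣c) = b-c (ℕ.coprime-divisor d-a d∣ab , d∣c)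
  where
  d-a : Coprime d a
  d-a (e∣d , e∣a) = a-c (e∣a , ℕ.∣-trans e∣d d∣c)

coprime-^ˡ : ∀ {a c} k → Coprime a c → Coprime (a ^ k) c
coprime-^ˡ zero    a-c = ℕ.1-coprimeTo _
coprime-^ˡ (suc k) a-c = coprime-*ˡ a-c (coprime-^ˡ k a-c)

^12-∣124416 : ∀ {i} → i ^ 12 ℕ.∣ 124416 → i ≡ 1
^12-∣124416 {0} 0∣ = contradiction 0∣ (from-no (0 ℕ.∣? 124416))
^12-∣124416 {1} _ = refl
^12-∣124416 {2} 2^12∣ = contradiction 2^12∣ (from-no (4096 ℕ.∣? 124416))
^12-∣124416 {suc (suc (suc i))} i^12∣ = contradiction
  (ℕ.≤-trans (ℕ.^-monoˡ-≤ 12 {3} {3 ℕ.+ i} (s≤s (s≤s (s≤s z≤n)))) (ℕ.∣⇒≤ i^12∣))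
  (from-no (531441 ℕ.≤? 124416))

^12-≤1 : ∀ {j} → j ≢ 0 → j ^ 12 * 124416 ℕ.≤ 124416 → j ≡ 1
^12-≤1 {0} j≢0 _ = ⊥-elim (j≢0 refl)
^12-≤1 {1} _ _ = refl
^12-≤1 {suc (suc j)} _ ≤124416 = contradiction
  (ℕ.≤-trans (ℕ.*-monoˡ-≤ 124416 (ℕ.^-monoˡ-≤ 12 {2} {2 ℕ.+ j} (s≤s (s≤s z≤n)))) ≤124416)
  (from-no (4096 * 124416 ℕ.≤? 124416))

unit-^ : ∀ {i k} → ∣ i ∣ ≡ 1 → i ℤ.^ (2 * k) ≡ + 1
unit-^ {i} {k} ∣i∣≡1 = trans (sym (ℤ.^-*-assoc i 2 k)) (trans (cong (ℤ._^ k) (square (unit ∣i∣≡1))) (ℤ.^-zeroˡ k))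
  where
  square : i ≡ + 1 ⊎ i ≡ -[1+ 0 ] → i ℤ.^ 2 ≡ + 1
  square (inj₁ refl) = refl
  square (inj₂ refl) = refl

-- 124416 = 2⁹ · 3⁵ is divisible by no twelfth power other than 1.
equal-invariants : ∀ {W W′} → Comparison W W′ → WeierstrassOver.Δ ℤ-ring W′ ≡ - + 124416 →
  ∣ WeierstrassOver.Δ ℤ-ring W ∣ ℕ.≤ 124416 →
  WeierstrassOver.Δ ℤ-ring W ≡ - + 124416 × c₄ ℤ-ring W ≡ c₄ ℤ-ring W′
equal-invariants {W} {W′} C Δ′≡ ∣Δ∣≤ =
  units 6 {Δ} {Δ₀} (trans Δ-eq (cong (j ℤ.^ 12 ℤ.*_) Δ′≡)) ,
  units 2 c₄-eq
  where
  open Comparison C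
  Δ Δ₀ : ℤ
  Δ = WeierstrassOver.Δ ℤ-ring W
  Δ₀ = - + 124416
  ∣Δ∣-eq : ∣ i ∣ ^ 12 * ∣ Δ ∣ ≡ ∣ j ∣ ^ 12 * 124416
  ∣Δ∣-eq = trans (sym (∣-^* i 12 Δ))
    (trans (cong ∣_∣ (trans Δ-eq (cong (j ℤ.^ 12 ℤ.*_) Δ′≡))) (∣-^* j 12 Δ₀))
  -- i¹² divides j¹² · 124416 and is prime to j¹².
  ∣i∣≡1 : ∣ i ∣ ≡ 1
  ∣i∣≡1 = ^12-∣124416 (ℕ.coprime-divisor
    (coprime-^ˡ 12 (ℕ.sym (coprime-^ˡ 12 (ℕ.sym coprime))))
    (subst (∣ i ∣ ^ 12 ℕ.∣_) ∣Δ∣-eq (ℕ.m∣m*n ∣ Δ ∣)))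
  -- Now |Δ| = |j|¹² · 124416, and the assumed bound on |Δ| applies.
  ∣j∣≡1 : ∣ j ∣ ≡ 1
  ∣j∣≡1 = ^12-≤1 (j≢0 ∘ ℤ.∣i∣≡0⇒i≡0)
    (subst (ℕ._≤ 124416) (trans (sym (ℕ.*-identityˡ ∣ Δ ∣))
      (trans (cong (λ z → z ^ 12 * ∣ Δ ∣) (sym ∣i∣≡1)) ∣Δ∣-eq)) ∣Δ∣≤)
  -- Only even powers of i and j occur, so their signs drop out and Δ is determined together with
  -- its sign.
  units : ∀ k {x x′} → i ℤ.^ (2 * k) ℤ.* x ≡ j ℤ.^ (2 * k) ℤ.* x′ → x ≡ x′
  units k {x} {x′} eq = trans (sym (ℤ.*-identityˡ x)) (trans (cong (ℤ._* x) (sym (unit-^ {i} {k} ∣i∣≡1)))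
    (trans eq (trans (cong (ℤ._* x′) (unit-^ {j} {k} ∣j∣≡1)) (ℤ.*-identityˡ x′))))

-- The discriminant of the quadratic part at a singular point is b₂ modulo 3,
-- and c₄ is b₂² modulo 3.
3∣c₄⇒no-node : ∀ {W x y} → + 3 ∣ᶻ c₄ ℤ-ring W → ¬ Reduction.NodeAt W 3 x y
3∣c₄⇒no-node {W@(weierstrass a₁ a₂ a₃ a₄ a₆)} {x} 3∣c₄ (_ , distinct) = distinct (a₁
  -- The double root α = -a₁ / 2 is a₁ itself modulo 3.
  , ∣⇒∣ᵤ (divides a₁ (solve 1 (λ a → a ⊕ Κ (+ 2) ⊗ a ⊜ a ⊗ Κ (+ 3)) refl a₁))
  , ∣⇒∣ᵤ (subst (+ 3 ∣ᶻ_) (solve 3 (λ a₁ a₂ x →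
      (a₁ ^ᴱ 2 ⊕ 4 ·ᴱ a₂) ⊕ Κ (+ 3) ⊗ (x ⊖ a₂) ⊜ a₁ ⊗ a₁ ⊕ (Κ (+ 3) ⊗ x ⊕ a₂)) refl a₁ a₂ x)
      (∣m∣n⇒∣m+n 3∣b₂ (∣m⇒∣m*n (x ℤ.- a₂) (divides (+ 1) refl)))))
  where
  open WeierstrassOver ℤ-ring W using (b₂; b₄)
  3∣b₂ : + 3 ∣ᶻ b₂
  3∣b₂ = euclid² prime[3] (subst (+ 3 ∣ᶻ_)
    (solve 2 (λ b₂ b₄ → (b₂ ^ᴱ 2 ⊖ 24 ·ᴱ b₄) ⊕ Κ (+ 3) ⊗ (Κ (+ 8) ⊗ b₄) ⊜ b₂ ⊗ b₂) refl b₂ b₄)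
    (∣m∣n⇒∣m+n 3∣c₄ (∣m⇒∣m*n (+ 8 ℤ.* b₄) (divides (+ 1) refl))))

module _ {E : EllipticCurve} {N : ℕ} (conductor : IsConductor E N) where
  open IsConductor conductor

  ∣Δ⇒∣N : ∀ {r} → Prime r → r ℕ.∣ ∣ WeierstrassOver.Δ ℤ-ring model ∣ → r ℕ.∣ N
  ∣Δ⇒∣N {r} r-prime r∣Δ with exponent r r-prime
  ... | _ , good r∤Δ , _ = ⊥-elim (r∤Δ r∣Δ)
  ... | _ , multiplicative _ , r^1∣N , _ = ℕ.∣-trans (ℕ.m∣m*n _) r^1∣N
  ... | _ , additive _ _ , r^e∣N , _ = ℕ.∣-trans (ℕ.m∣m*n _) r^e∣N

  -- Bad reduction without a node is a cusp, with exponent 2 + δ. The exponent 2 already gives the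
  -- factor 9, so the wild part δ at 3 never has to be computed.
  additive-3⇒9∣N : 3 ℕ.∣ ∣ WeierstrassOver.Δ ℤ-ring model ∣ → + 3 ∣ᶻ c₄ ℤ-ring model → 9 ℕ.∣ N
  additive-3⇒9∣N 3∣Δ 3∣c₄ with exponent 3 prime[3]
  ... | _ , good 3∤Δ , _ = ⊥-elim (3∤Δ 3∣Δ)
  ... | _ , multiplicative {x} {y} node , _ = ⊥-elim (3∣c₄⇒no-node {model} {x} {y} 3∣c₄ node)
  ... | suc (suc δ) , additive _ _ , 3^e∣N , _ = ℕ.∣-trans
    (ℕ.divides (3 ^ δ) (trans (sym (ℕ.*-assoc 3 3 (3 ^ δ))) (ℕ.*-comm 9 (3 ^ δ)))) 3^e∣N

prime-∣pq : ∀ {p q r} α β → Prime p → Prime q → Prime r → r ℕ.∣ p ^ α * q ^ β → r ≡ p ⊎ r ≡ q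
prime-∣pq {p} {q} α β p-prime q-prime r-prime r∣ =
  [ inj₁ ∘ prime-∣⇒≡ r-prime p-prime ∘ prime-∣^ r-prime p α
  , inj₂ ∘ prime-∣⇒≡ r-prime q-prime ∘ prime-∣^ r-prime q β ]′ (euclidsLemma (p ^ α) (q ^ β) r-prime r∣)

order-9-exceptional : ∀ {E N} → HasRationalPointOfOrder E 9 → IsConductor E N →
  ∀ {p q α β} → Prime p → Prime q → N ≡ p ^ α * q ^ β →
  ∃[ m ] ∃[ n ] Exceptional m n × IsIntegralModel E (integralModel m n)
order-9-exceptional {E} order-9 conductor {p} {q} {α} {β} p-prime q-prime refl =
  let m , k , coprime , m≢0 , m-n≢0 , iso = order-9⇒integralModel {E} order-9
      n = + suc k
      open IsConductor conductor
      two-primes : ∀ {r} → Prime r → Coprimality.NodePrime {m} {n} coprime r → r ≡ p ⊎ r ≡ q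
      two-primes r-prime node = prime-∣pq α β p-prime q-prime r-prime (∣Δ⇒∣N conductor r-prime
        (Coprimality.nodePrime⇒∣Δ coprime (compare {E} model (integralModel m n) (proj₁ minimal) iso) r-prime node))
  in m , n , ∣F∣≡1∨3⇒exceptional m k m≢0 m-n≢0 (∣F∣≡1∨3 {m} {n} coprime m≢0 (λ ()) m-n≢0 two-primes) , iso

exceptional-invariants : ∀ {E m n} W → Exceptional m n → IsIntegralModel E (integralModel m n) →
  IsMinimalModel E W →
  WeierstrassOver.Δ ℤ-ring W ≡ - + 124416 × c₄ ℤ-ring W ≡ c₄ ℤ-ring (integralModel m n)
exceptional-invariants {E} {m} {n} W exceptional iso (iso′ , minimal) = equal-invariants
  (compare {E} W (integralModel m n) iso′ iso) (exceptional-Δ exceptional)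
  (subst (ℕ._≤_ ∣ WeierstrassOver.Δ ℤ-ring W ∣) (cong ∣_∣ (exceptional-Δ exceptional))
    (minimal (integralModel m n) iso))

-- The minimal model behind `D` and the one behind `N` may differ; each is compared with the
-- exceptional model separately.
discriminant∧conductor-bound : ∀ (E : EllipticCurve) (D : ℤ) (N : ℕ) →
  HasRationalPointOfOrder E 9 → IsMinimalDiscriminant E D → IsConductor E N →
  ∀ (p q α β : ℕ) → Prime p → Prime q → N ≡ p ^ α * q ^ β →
  D ≡ - + 124416 × 18 ℕ.≤ N
discriminant∧conductor-bound E D N order-9 (W , W-minimal , refl) conductor p q α β p-prime q-prime N≡ =
  let m , n , exceptional , iso = order-9-exceptional {E} order-9 conductor {p} {q} {α} {β} p-prime q-prime N≡
      open IsConductor conductor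
      Δ≡ , c₄≡ = exceptional-invariants {E} model exceptional iso minimal
      ∣Δ∣≡ = cong ∣_∣ Δ≡
      2∣N = ∣Δ⇒∣N conductor prime[2] (subst (2 ℕ.∣_) (sym ∣Δ∣≡) (from-yes (2 ℕ.∣? 124416)))
      9∣N = additive-3⇒9∣N conductor (subst (3 ℕ.∣_) (sym ∣Δ∣≡) (from-yes (3 ℕ.∣? 124416)))
              (subst (+ 3 ∣ᶻ_) (sym c₄≡) (exceptional-c₄ exceptional))
  in proj₁ (exceptional-invariants {E} W exceptional iso W-minimal) , 18≤ positive 2∣N 9∣N
  where
  18≤ : ∀ {N} → 0 < N → 2 ℕ.∣ N → 9 ℕ.∣ N → 18 ℕ.≤ N
  18≤ {N} 0<N 2∣N (ℕ.divides q refl) = ℕ.∣⇒≤ {{ℕ.>-nonZero 0<N}}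
    (ℕ.*-monoˡ-∣ 9 (ℕ.coprime-divisor {n = 9} {o = q} (from-yes (ℕ.coprime? 2 9))
      (subst (2 ℕ.∣_) (ℕ.*-comm q 9) 2∣N)))

theorem3p8 : (∀ (E : EllipticCurve) (D : ℤ) (N : ℕ) →
    HasRationalPointOfOrder E 9 → IsMinimalDiscriminant E D → IsConductor E N →
    ∀ (p q α β : ℕ) → Prime p → Prime q → p ≢ q → 0 < α → 0 < β → N ≡ p ^ α * q ^ β →
    (D ≡ - (+ (2 ^ 9 * 3 ^ 5))) × (∣ D ∣ < N ^ 5))
    ×
    (∀ (ε : ℝ) → Positive ε → ∃ λ (C : ℕ) →
    ∀ (E : EllipticCurve) (D : ℤ) (N : ℕ) →
    HasRationalPointOfOrder E 9 → IsMinimalDiscriminant E D → IsConductor E N →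
    ∀ (p q α β : ℕ) → Prime p → Prime q → p ≢ q → 0 < α → 0 < β → N ≡ p ^ α * q ^ β →
    ∣ D ∣ ≤ C · N ^[6+ ε ])
theorem3p8 =
  (λ E D N order-9 minimal conductor p q α β p-prime q-prime _ _ _ N≡ →
    let D≡ , 18≤N = discriminant∧conductor-bound E D N order-9 minimal conductor p q α β p-prime q-prime N≡
    in D≡ , ℕ.<-≤-trans
         (subst (_< 18 ^ 5) (sym (cong ∣_∣ D≡)) (from-yes (124416 ℕ.<? 18 ^ 5))) (ℕ.^-monoˡ-≤ 5 18≤N))
  -- |D| takes a single value on all these curves, so this value is a constant for every ε; what is
  -- left is that powers of N are at least 1.
  , λ ε _ → 124416 , λ E D N order-9 minimal conductor p q α β p-prime q-prime _ _ _ N≡ r _ →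
    let D≡ , 18≤N = discriminant∧conductor-bound E D N order-9 minimal conductor p q α β p-prime q-prime N≡
    in szpiro D≡ (ℕ.<-≤-trans z<s 18≤N) (ℤ→ℚ (+ 6) ℚ.+ r)
  where
  szpiro : ∀ {D N} → D ≡ - + 124416 → 0 < N → ∀ r → ∣ D ∣ ≤ 124416 · N ^ℚ r
  szpiro {N = N} refl 0<N r = ℕ.m≤m*n _ _ {{ℕ.m^n≢0 N ∣ ℚ.↥ r ∣ {{ℕ.>-nonZero 0<N}}}}
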